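{- The problem $F_3||\sum_{J_j\in E} w_j$ (just-in-time flow-shop scheduling on three machines) with $n$ jobs and $\#d$ different due dates is solvable in $O(n^{\#d+1}\,\#d!)$ time, and thus belongs to XP with respect to the parameter $\#d$.
   Context: JIT flow-shop problem $F_m||\sum_{J_j\in E}w_j$: an instance consists of $n$ independent, non-preemptive jobs $\mathcal J=\{J_1,\dots,J_n\}$, all available at time $0$, and $m$ machines $M_1,\dots,M_m$. Job $J_j$ has a processing time $p^{(i)}_j$ on each machine $M_i$, a due date $d_j$ and a weight $w_j$; all these numbers are positive integers. Every scheduled job must be processed first on $M_1$, then on $M_2$, and so on up to $M_m$; its processing on $M_i$ cannot start before its processing on $M_{i-1}$ is completed; each machine processes at most one job at a time; idle time and waiting between machines are allowed, and the processing orders on different machines may differ. A job is scheduled in JIT mode if its processing on $M_m$ is completed exactly at time $d_j$. A partition $\mathcal J=E\cup T$ is feasible if the jobs of $E$ can all be scheduled in JIT mode (jobs of $T$ are rejected and are not processed). The goal is to find a feasible partition maximizing $\sum_{J_j\in E}w_j$. $\#d$ is the number of distinct values among the due dates $d_1,\dots,d_n$. Running times count elementary arithmetic operations and comparisons on the input numbers as single steps. A problem belongs to XP with respect to a parameter $k$ if every instance of size $n$ can be solved in $n^{f(k)}$ time for a computable function $f$ depending only on $k$. -}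

module Defs where

open import Data.Bool.Base using (if_then_else_; _∧_)
open import Data.Fin.Base using (Fin; toℕ)
open import Data.Fin.Subset using (Subset; _∈_)
open import Data.Integer.Base using (+_)
open import Data.List.Base using (List; []; _∷_; _++_; concat; deduplicate; length; sum; tabulate)
open import Data.Nat.Base using (ℕ; zero; suc; _+_; _*_; _∸_; _^_; _⊔_; _≤_; _<_; _≡ᵇ_; _<ᵇ_)
open import Data.Nat.Properties using (_≟_)
open import Data.Product.Base using (Σ-syntax; ∃-syntax; _×_)
open import Data.Rational.Base as ℚ using (ℚ; 0ℚ)
open import Data.Sum.Base using (_⊎_)
import Data.Vec.Base as Vec
open import Relation.Binary.PropositionalEquality using (_≡_; _≢_)

-- A unit-cost random access machine, as structured programs over unbounded
-- natural numbers.  The memory consists of zero-initialised infinite arrays;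
-- an array name is a constant of the program text, so a program uses only
-- finitely many arrays, while the index into an array is computed.  There is
-- deliberately no multiplication: at unit cost it would make the machine
-- unrealistically powerful.

infixl 6 _⊕_ _⊖_
infix  8 _[_]
infix  4 _[_]≔_
infixr 3 _⨾_

data Expr : Set where
  lit     : ℕ → Expr
  _[_]    : (a : ℕ) (index : Expr) → Expr
  _⊕_ _⊖_ : Expr → Expr → Expr

data Test : Set where
  _⊑_ : Expr → Expr → Test

data Program : Set where
  skip          : Program
  _[_]≔_        : (a : ℕ) (index value : Expr) → Program
  _⨾_           : Program → Program → Program
  if_then_else′_ : Test → Program → Program → Program
  while_repeat_ : Test → Program → Program

Store : Set
Store = ℕ → ℕ → ℕ

_[_,_↦_] : Store → ℕ → ℕ → ℕ → Store
(σ [ a , i ↦ v ]) b j = if (b ≡ᵇ a) ∧ (j ≡ᵇ i) then v else σ b j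

⟦_⟧ : Expr → Store → ℕ
⟦ lit k   ⟧ σ = k
⟦ a [ e ] ⟧ σ = σ a (⟦ e ⟧ σ)
⟦ e ⊕ e′  ⟧ σ = ⟦ e ⟧ σ + ⟦ e′ ⟧ σ
⟦ e ⊖ e′  ⟧ σ = ⟦ e ⟧ σ ∸ ⟦ e′ ⟧ σ

cost : Expr → ℕ
cost (lit k)   = 1
cost (a [ e ]) = suc (cost e)
cost (e ⊕ e′)  = suc (cost e + cost e′)
cost (e ⊖ e′)  = suc (cost e + cost e′)

Holds Fails : Test → Store → Set
Holds (e ⊑ e′) σ = ⟦ e ⟧ σ ≤ ⟦ e′ ⟧ σ
Fails (e ⊑ e′) σ = ⟦ e′ ⟧ σ < ⟦ e ⟧ σ

testCost : Test → ℕ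
testCost (e ⊑ e′) = suc (cost e + cost e′)

-- Exec P σ t σ′: started in σ, the program P halts after t steps in σ′.

data Exec : Program → Store → ℕ → Store → Set where
  skip       : ∀ {σ} → Exec skip σ 1 σ
  assign     : ∀ {a e v σ} →
               Exec (a [ e ]≔ v) σ (suc (cost e + cost v))
                    (σ [ a , ⟦ e ⟧ σ ↦ ⟦ v ⟧ σ ])
  seq        : ∀ {P Q σ σ′ σ″ t t′} →
               Exec P σ t σ′ → Exec Q σ′ t′ σ″ →
               Exec (P ⨾ Q) σ (t + t′) σ″
  if-true    : ∀ {b P Q σ σ′ t} → Holds b σ → Exec P σ t σ′ →
               Exec (if b then P else′ Q) σ (testCost b + t) σ′
  if-false   : ∀ {b P Q σ σ′ t} → Fails b σ → Exec Q σ t σ′ →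
               Exec (if b then P else′ Q) σ (testCost b + t) σ′
  while-stop : ∀ {b P σ} → Fails b σ →
               Exec (while b repeat P) σ (testCost b) σ
  while-step : ∀ {b P σ σ′ σ″ t t′} → Holds b σ → Exec P σ t σ′ →
               Exec (while b repeat P) σ′ t′ σ″ →
               Exec (while b repeat P) σ (testCost b + (t + t′)) σ″

-- The input is read from array 0 and the output from array 1.

nth : List ℕ → ℕ → ℕ
nth []       _       = 0
nth (x ∷ _)  zero    = x
nth (_ ∷ xs) (suc i) = nth xs i

load : List ℕ → Store
load xs zero    i = nth xs i
load xs (suc _) i = 0

Runs : Program → List ℕ → ℕ → (ℕ → ℕ) → Set
Runs P input t output = Σ[ σ ∈ Store ] Exec P (load input) t σ × output ≡ σ 1

record Problem : Set₁ where
  field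
    Instance : Set
    encode   : Instance → List ℕ
    Solution : Instance → (ℕ → ℕ) → Set

module _ (Π : Problem) where
  open Problem Π

  SolvesWithin : Program → (Instance → ℕ) → Set
  SolvesWithin P T = ∀ x → ∃[ t ] ∃[ output ]
    Runs P (encode x) t output × Solution x output × t ≤ T x

  -- The bound is 1 ⊔ T rather than T, since no program runs in 0 steps.

  SolvableInO : (Instance → ℕ) → Set
  SolvableInO T = ∃[ P ] ∃[ C ] SolvesWithin P (λ x → C * (1 ⊔ T x))

Computable : (ℕ → ℕ) → Set
Computable f = ∃[ P ] ∀ k → ∃[ t ] ∃[ output ]
  Runs P (k ∷ []) t output × output 0 ≡ f k

-- The size of an instance is the number of integers in its encoding, in
-- accordance with the unit cost of operations on them.  It is read as
-- 2 ⊔ size, as powers of a size ≤ 1 bound every running time by 1.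

module _ (Π : Problem) where
  open Problem Π

  XP : (Instance → ℕ) → Set
  XP κ = ∃[ f ] Computable f ×
    ∃[ P ] SolvesWithin Π P (λ x → (2 ⊔ length (encode x)) ^ f (κ x))

record FlowShop (m : ℕ) : Set where
  field
    n   : ℕ
    p   : Fin m → Fin n → ℕ
    d   : Fin n → ℕ
    w   : Fin n → ℕ
    p>0 : ∀ i j → 0 < p i j
    d>0 : ∀ j → 0 < d j
    w>0 : ∀ j → 0 < w j

  #d : ℕ
  #d = length (deduplicate _≟_ (tabulate d))

toℚ : ℕ → ℚ
toℚ k = + k ℚ./ 1

module _ {m : ℕ} (I : FlowShop m) where
  open FlowShop I

  -- Start times; those of the jobs outside E are irrelevant.

  record JITSchedule (E : Subset n) : Set where
    field
      start : Fin m → Fin n → ℚ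

    finish : Fin m → Fin n → ℚ
    finish i j = start i j ℚ.+ toℚ (p i j)

    field
      available : ∀ i j → j ∈ E → 0ℚ ℚ.≤ start i j
      flow      : ∀ i i′ j → toℕ i′ ≡ suc (toℕ i) → j ∈ E →
                  finish i j ℚ.≤ start i′ j
      capacity  : ∀ i j j′ → j ∈ E → j′ ∈ E → j ≢ j′ →
                  finish i j ℚ.≤ start i j′ ⊎ finish i j′ ℚ.≤ start i j
      jit       : ∀ i j → suc (toℕ i) ≡ m → j ∈ E →
                  finish i j ≡ toℚ (d j)

  -- A partition of the jobs into E and T is represented by E.

  Feasible : Subset n → Set
  Feasible = JITSchedule

  weight : Subset n → ℕ
  weight E = sum (tabulate λ j → if Vec.lookup E j then w j else 0)

  Optimal : Subset n → Set
  Optimal E = Feasible E × (∀ E′ → Feasible E′ → weight E′ ≤ weight E)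

  -- The encoding is n followed by one block p₁ⱼ, …, pₘⱼ, dⱼ, wⱼ per job j.

  encodeFlowShop : List ℕ
  encodeFlowShop =
    n ∷ concat (tabulate λ j → tabulate (λ i → p i j) ++ d j ∷ w j ∷ [])

  -- Job j is in E precisely if the output is nonzero at position j.

  decodeSubset : (ℕ → ℕ) → Subset n
  decodeSubset output = Vec.tabulate λ j → 0 <ᵇ output (toℕ j)

JITFlowShop : ℕ → Problem
JITFlowShop m = record
  { Instance = FlowShop m
  ; encode   = encodeFlowShop
  ; Solution = λ I output → Optimal I (decodeSubset I output)
  }

{-# OPTIONS --safe #-}

-- A sequence of jobs is good if, processed greedily in this order on the first
-- two machines, each job reaches the last machine by its latest start time, and
-- the intervals that the due dates impose on the last machine are disjoint.
-- Good sequences yield just-in-time schedules.  Conversely, the jobs of any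
-- schedule, sorted by their start times on the second machine, form a good
-- sequence: when a job starts there, all jobs up to it have left the first
-- machine.  Jobs with the same due date clash on the last machine, so a good
-- sequence has at most #d jobs.
--
-- The program builds the tree of all good sequences breadth first, appending
-- every job to every sequence found.  It never computes #d: the depth bound
-- alone limits the tree to O(n ^ #d) nodes.  Each node costs n tests of O(#d)
-- steps, and #d ≤ #d !.

module Submission where

open import Defs
open import Data.Bool.Base using (Bool; true; false; if_then_else_; not; _∧_)
open import Data.Bool.Properties using (T?; T-≡; ∧-conicalˡ; ∧-conicalʳ)
open import Data.Fin.Base using (Fin; zero; suc; toℕ; fromℕ<)
open import Data.Fin.Patterns using (0F; 1F; 2F)
import Data.Fin.Properties as Fin
open import Data.Fin.Subset as Subset using (Subset)
import Data.Integer.Base as ℤ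
import Data.Integer.Properties as ℤ
open import Data.List.Base as List
  using (List; []; _∷_; _++_; length; map; filter; concat; deduplicate; tabulate; allFin)
open import Data.List.Membership.Propositional using (_∈_)
open import Data.List.Membership.Propositional.Properties
  using (∈-filter⁺; ∈-filter⁻; ∈-allFin; ∈-tabulate⁺; ∈-map⁻; ∈-deduplicate⁺; ∈-lookup)
open import Data.List.Membership.Propositional.Properties.WithK using (unique∧set⇒bag)
open import Data.List.Properties
  using (map-tabulate; length-map; length-++; length-deduplicate; length-tabulate)
open import Data.List.Relation.Binary.BagAndSetEquality using (∼bag⇒↭)
open import Data.List.Relation.Binary.Permutation.Propositional using (_↭_; ↭-sym; ↭⇒↭ₛ)
open import Data.List.Relation.Binary.Permutation.Propositional.Properties using (All-resp-↭; map⁺)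
open import Data.List.Relation.Binary.Permutation.Setoid.Properties using (Unique-resp-↭)
open import Data.List.Relation.Unary.All as All using (All; []; _∷_)
import Data.List.Relation.Unary.All.Properties as All
open import Data.List.Relation.Unary.AllPairs using (AllPairs; []; _∷_)
open import Data.List.Relation.Unary.Any as Any using (here; there)
open import Data.List.Relation.Unary.Any.Properties using (lookup-index)
open import Data.List.Relation.Unary.Sorted.TotalOrder.Properties using (Sorted⇒AllPairs)
open import Data.List.Relation.Unary.Unique.Propositional using (Unique)
import Data.List.Relation.Unary.Unique.Propositional.Properties as Unique
open import Data.List.Sort using (sort; sort-↭; sort-↗)
open import Data.Nat.Base
open import Data.Nat.Coprimality using (1-coprimeTo) renaming (sym to coprime-sym)
open import Data.Nat.ListAction using (sum)
open import Data.Nat.ListAction.Properties using (sum-↭)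
open import Data.Nat.Properties
open import Data.Nat.Tactic.RingSolver using (solve-∀)
open import Data.Product.Base using (_×_; _,_; proj₁; proj₂; ∃-syntax)
open import Data.Rational.Base as ℚ using (ℚ; 0ℚ; mkℚ)
import Data.Rational.Properties as ℚ
open import Data.Sum.Base as Sum using (_⊎_; inj₁; inj₂)
import Data.Vec.Base as Vec
import Data.Vec.Properties as Vec
open import Function.Base using (_∘_; id; case_of_)
open import Function.Bundles using (_⇔_; mk⇔; Equivalence)
open import Relation.Binary.Bundles using (DecTotalOrder)
import Relation.Binary.Construct.Flip.EqAndOrd as Flip
import Relation.Binary.Construct.On as On
open import Relation.Binary.PropositionalEquality hiding ([_]; J)
open import Relation.Nullary using (¬_; does; yes; no; contradiction)

-- Resource-bounded execution

record Run (P : Program) (σ : Store) (c : ℕ) (Q : Store → Set) : Set where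
  constructor run
  field
    {steps} : ℕ
    {final} : Store
    exec    : Exec P σ steps final
    bound   : steps ≤ c
    post    : Q final

private variable
  P P′        : Program
  b           : Test
  e v         : Expr
  σ σ′        : Store
  a c c′ t    : ℕ
  Q R         : Store → Set

run-weaken : Run P σ c Q → c ≤ c′ → Run P σ c′ Q
run-weaken (run x t≤c q) c≤c′ = run x (≤-trans t≤c c≤c′) q

run-map : (∀ {σ} → Q σ → R σ) → Run P σ c Q → Run P σ c R
run-map f (run x t≤c q) = run x t≤c (f q)

run-skip : Q σ → Run skip σ 1 Q
run-skip = run skip ≤-refl

run-assign : Q (σ [ a , ⟦ e ⟧ σ ↦ ⟦ v ⟧ σ ]) → Run (a [ e ]≔ v) σ (suc (cost e + cost v)) Q
run-assign = run assign ≤-refl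

infixr 3 _⨟_

_⨟_ : Run P σ c Q → (∀ {σ′} → Q σ′ → Run P′ σ′ c′ R) → Run (P ⨾ P′) σ (c + c′) R
run x t≤c q ⨟ f with f q
... | run y u≤c′ r = run (seq x y) (+-mono-≤ t≤c u≤c′) r

-- Unlike `_⨟_`, which passes on only a postcondition, this continues from the updated store itself,
-- so that reads of the assigned cell compute.
run-assign-then : Run P (σ [ a , ⟦ e ⟧ σ ↦ ⟦ v ⟧ σ ]) c Q →
                  Run ((a [ e ]≔ v) ⨾ P) σ (suc (cost e + cost v) + c) Q
run-assign-then (run x t≤c q) = run (seq assign x) (+-monoʳ-≤ _ t≤c) q

run-if : (Holds b σ → Run P σ c Q) → (Fails b σ → Run P′ σ c Q) →
         Run (if b then P else′ P′) σ (testCost b + c) Q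
run-if {b = e ⊑ e′} {σ} f g with ≤-<-connex (⟦ e ⟧ σ) (⟦ e′ ⟧ σ)
... | inj₁ h with run x t≤c q ← f h = run (if-true h x) (+-monoʳ-≤ _ t≤c) q
... | inj₂ h with run x t≤c q ← g h = run (if-false h x) (+-monoʳ-≤ _ t≤c) q

-- `I i` is the invariant after `i` rounds. A successful test forces `i < N`, so `N ≤ i + r` leaves
-- at most `r` further rounds, and the recursion is on `r`.
run-while : (I : ℕ → Store → Set) (N : ℕ) →
            (∀ {i σ} → I i σ → Holds b σ → i < N × Run P σ c (I (suc i))) →
            ∀ r {i} → N ≤ i + r → I i σ →
            Run (while b repeat P) σ (testCost b + r * (testCost b + c))
                (λ σ′ → Fails b σ′ × ∃[ i ] I i σ′)
run-while {b = e ⊑ e′} {σ = σ} I N step r {i} N≤i+r I-i with ≤-<-connex (⟦ e ⟧ σ) (⟦ e′ ⟧ σ)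
... | inj₂ h = run (while-stop h) (m≤m+n _ _) (h , i , I-i)
... | inj₁ h with i<N , run x t≤c q ← step I-i h with r
... | zero = contradiction (≤-trans i<N (subst (N ≤_) (+-identityʳ i) N≤i+r)) (n≮n i)
... | suc r with run y u≤ q′ ← run-while I N step r (subst (N ≤_) (+-suc i r) N≤i+r) q =
  run (while-step h x y)
      (+-monoʳ-≤ k (≤-trans (+-mono-≤ t≤c u≤) (≤-reflexive lemma))) q′
  where
  k = testCost (e ⊑ e′)
  lemma : ∀ {c x} → c + (k + x) ≡ k + c + x
  lemma {c} {x} = trans (sym (+-assoc c k x)) (cong (_+ x) (+-comm c k))

infix 4 _∉ᵂ_

-- Boolean-valued, so that for a concrete array and program the condition is proved by `refl`.
_∉ᵂ_ : ℕ → Program → Bool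
a ∉ᵂ skip                     = true
a ∉ᵂ (a′ [ _ ]≔ _)            = not (a ≡ᵇ a′)
a ∉ᵂ (P ⨾ P′)                 = (a ∉ᵂ P) ∧ (a ∉ᵂ P′)
a ∉ᵂ (if _ then P else′ P′)   = (a ∉ᵂ P) ∧ (a ∉ᵂ P′)
a ∉ᵂ (while _ repeat P)       = a ∉ᵂ P

-- Matching on the comparison makes both sides η-equal, so that whole arrays
-- are equal without function extensionality.
update-other : ∀ σ a b i v → not (a ≡ᵇ b) ≡ true → (σ [ b , i ↦ v ]) a ≡ σ a
update-other σ a b i v = helper (a ≡ᵇ b)
  where
  helper : ∀ x → not x ≡ true → (λ j → if x ∧ (j ≡ᵇ i) then v else σ a j) ≡ σ a
  helper false _ = refl

frame : ∀ {a} → Exec P σ t σ′ → (a ∉ᵂ P) ≡ true → σ′ a ≡ σ a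
frame skip                          _  = refl
frame (assign {b} {e} {v} {σ})      a∉ = update-other σ _ b (⟦ e ⟧ σ) (⟦ v ⟧ σ) a∉
frame (seq {P} x y)                 a∉ = trans (frame y (∧-conicalʳ (_ ∉ᵂ P) _ a∉))
                                               (frame x (∧-conicalˡ (_ ∉ᵂ P) _ a∉))
frame (if-true {P = P} _ x)         a∉ = frame x (∧-conicalˡ (_ ∉ᵂ P) _ a∉)
frame (if-false {P = P} _ x)        a∉ = frame x (∧-conicalʳ (_ ∉ᵂ P) _ a∉)
frame (while-stop _)                _  = refl
frame (while-step _ x y)            a∉ = trans (frame y a∉) (frame x a∉)

run-frame : Run P σ c Q → Run P σ c (λ σ′ → Q σ′ × (∀ a → (a ∉ᵂ P) ≡ true → σ′ a ≡ σ a))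
run-frame (run x t≤c q) = run x t≤c (q , λ a → frame x)

-- ℕ in ℚ

-- The division in `toℚ` normalises by a gcd, which is stuck on a variable; the right-hand side
-- exposes numerator and denominator, so that facts about `ℤ` apply.
toℚ-mkℚ : ∀ k → toℚ k ≡ mkℚ (ℤ.+ k) 0 (coprime-sym (1-coprimeTo k))
toℚ-mkℚ k = ℚ.normalize-coprime (coprime-sym (1-coprimeTo k))

toℚ-+ : ∀ a b → toℚ (a + b) ≡ toℚ a ℚ.+ toℚ b
toℚ-+ a b = trans
  (cong (ℚ._/ 1) (cong₂ ℤ._+_ (sym (ℤ.*-identityʳ (ℤ.+ a))) (sym (ℤ.*-identityʳ (ℤ.+ b)))))
  (cong₂ ℚ._+_ (sym (toℚ-mkℚ a)) (sym (toℚ-mkℚ b)))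

toℚ-mono-≤ : ∀ {a b} → a ≤ b → toℚ a ℚ.≤ toℚ b
toℚ-mono-≤ {a} {b} a≤b rewrite toℚ-mkℚ a | toℚ-mkℚ b =
  ℚ.*≤* (ℤ.*-monoʳ-≤-nonNeg (ℤ.+ 1) (ℤ.+≤+ a≤b))

toℚ-cancel-≤ : ∀ {a b} → toℚ a ℚ.≤ toℚ b → a ≤ b
toℚ-cancel-≤ {a} {b} le rewrite toℚ-mkℚ a | toℚ-mkℚ b =
  ℤ.drop‿+≤+ (ℤ.*-cancelʳ-≤-pos (ℤ.+ a) (ℤ.+ b) (ℤ.+ 1) (ℚ.drop-*≤* le))

toℚ-+-mono-≤ : ∀ a b {x y} → toℚ a ℚ.≤ x → toℚ b ℚ.≤ y → toℚ (a + b) ℚ.≤ x ℚ.+ y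
toℚ-+-mono-≤ a b a≤x b≤y =
  ℚ.≤-trans (ℚ.≤-reflexive (toℚ-+ a b)) (ℚ.+-mono-≤ a≤x b≤y)

toℚ-⊔-lub : ∀ {a b x} → toℚ a ℚ.≤ x → toℚ b ℚ.≤ x → toℚ (a ⊔ b) ℚ.≤ x
toℚ-⊔-lub {a} {b} a≤x b≤x with ⊔-sel a b
... | inj₁ eq rewrite eq = a≤x
... | inj₂ eq rewrite eq = b≤x

x+toℚ≰x : ∀ {x k} → 0 < k → ¬ x ℚ.+ toℚ k ℚ.≤ x
x+toℚ≰x {x} {k} 0<k le = <⇒≱ 0<k (toℚ-cancel-≤ (subst₂ ℚ._≤_ left (ℚ.+-inverseˡ x) (ℚ.+-monoʳ-≤ (ℚ.- x) le)))
  where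
  left : ℚ.- x ℚ.+ (x ℚ.+ toℚ k) ≡ toℚ k
  left = trans (sym (ℚ.+-assoc (ℚ.- x) x (toℚ k)))
    (trans (cong (ℚ._+ toℚ k) (ℚ.+-inverseˡ x)) (ℚ.+-identityˡ (toℚ k)))

-- Lists without repetition, sorting and truncated subtraction

Unique⇒lookup-injective : ∀ {A : Set} {xs : List A} → Unique xs →
                          ∀ i j → List.lookup xs i ≡ List.lookup xs j → i ≡ j
Unique⇒lookup-injective (_ ∷ _)    zero    zero    _  = refl
Unique⇒lookup-injective (x≢ ∷ _)   zero    (suc j) eq = contradiction eq (All.lookup x≢ (∈-lookup j))
Unique⇒lookup-injective (x≢ ∷ _)   (suc i) zero    eq = contradiction (sym eq) (All.lookup x≢ (∈-lookup i))
Unique⇒lookup-injective (_ ∷ xs!)  (suc i) (suc j) eq = cong suc (Unique⇒lookup-injective xs! i j eq)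

-- Pigeonhole principle: sending an index of `xs` to the position of its entry in `ys` is injective,
-- since equal positions hold equal entries.
Unique-⊆⇒length≤ : ∀ {A : Set} {xs ys : List A} → Unique xs → (∀ {x} → x ∈ xs → x ∈ ys) →
                   length xs ≤ length ys
Unique-⊆⇒length≤ {xs = xs} {ys} xs! xs⊆ys = Fin.injective⇒≤ {f = position} injective
  where
  position : Fin (length xs) → Fin (length ys)
  position i = Any.index (xs⊆ys (∈-lookup i))

  injective : ∀ {i j} → position i ≡ position j → i ≡ j
  injective {i} {j} eq = Unique⇒lookup-injective xs! i j
    (trans (lookup-index (xs⊆ys (∈-lookup i)))
      (trans (cong (List.lookup ys) eq) (sym (lookup-index (xs⊆ys (∈-lookup j))))))

sum-filter : ∀ {A : Set} (f : A → ℕ) (b : A → Bool) xs →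
             sum (map f (filter (T? ∘ b) xs)) ≡ sum (map (λ x → if b x then f x else 0) xs)
sum-filter f b []       = refl
sum-filter f b (x ∷ xs) with b x
... | true  = cong (f x +_) (sum-filter f b xs)
... | false = sum-filter f b xs

-- Descending, because a sequence carries the job processed last at its head.
sort-descending : ∀ {A : Set} (key : A → ℚ) xs →
                  ∃[ ys ] ys ↭ xs × AllPairs (λ x y → key y ℚ.≤ key x) ys
sort-descending key xs = sort O xs , sort-↭ O xs , Sorted⇒AllPairs (DecTotalOrder.totalOrder O) (sort-↗ O xs)
  where
  O = On.decTotalOrder (Flip.decTotalOrder ℚ.≤-decTotalOrder) key

-- The machine has no maximum operation; by this identity `probe` obtains one from truncated
-- subtraction.
m+[n∸m]≡m⊔n : ∀ m n → m + (n ∸ m) ≡ m ⊔ n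
m+[n∸m]≡m⊔n zero    n       = refl
m+[n∸m]≡m⊔n (suc m) zero    = +-identityʳ (suc m)
m+[n∸m]≡m⊔n (suc m) (suc n) = cong suc (m+[n∸m]≡m⊔n m n)

m∸[m∸n]≡0⇒ : ∀ m n → m ∸ (m ∸ n) ≡ 0 → m ≡ 0 ⊎ n ≡ 0
m∸[m∸n]≡0⇒ m n eq with ≤-total m n
... | inj₁ m≤n = inj₁ (trans (cong (m ∸_) (sym (m≤n⇒m∸n≡0 m≤n))) eq)
... | inj₂ n≤m = inj₂ (trans (sym (m∸[m∸n]≡n n≤m)) eq)

-- Good sequences of jobs

module Sequences (I : FlowShop 3) where
  open FlowShop I

  Seq : Set
  Seq = List (Fin n)

  -- The jobs of a sequence are processed from right to left, in the same order
  -- on the first two machines and as early as possible.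

  completion₁ completion₂ totalWeight : Seq → ℕ
  completion₁ L = sum (map (p 0F) L)

  completion₂ []      = 0
  completion₂ (j ∷ L) = completion₁ (j ∷ L) ⊔ completion₂ L + p 1F j

  totalWeight L = sum (map w L)

  lateness : Fin n → Seq → ℕ
  lateness j L = completion₂ (j ∷ L) + p 2F j ∸ d j

  -- The intervals of i and j on the last machine are disjoint if one of the
  -- differences x and y vanishes, and x ∸ (x ∸ y) = x ⊓ y.

  clash : Fin n → Fin n → ℕ
  clash i j = x ∸ (x ∸ y)
    where
    x = d i + p 2F j ∸ d j
    y = d j + p 2F i ∸ d i

  -- A sum of natural numbers vanishes only if every term does, so a single accumulator compared
  -- with 0 decides whether `j` may be appended.
  obstruction : Fin n → Seq → ℕ
  obstruction j L = lateness j L + sum (map (λ i → clash i j) L)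

  data Good : Seq → Set where
    []  : Good []
    _∷_ : ∀ {j L} → obstruction j L ≡ 0 → Good L → Good (j ∷ L)

  Disjoint₃ : Fin n → Fin n → Set
  Disjoint₃ i j = d i + p 2F j ≤ d j ⊎ d j + p 2F i ≤ d i

  clash≡0⇒Disjoint₃ : ∀ {i j} → clash i j ≡ 0 → Disjoint₃ i j
  clash≡0⇒Disjoint₃ {i} {j} eq =
    Sum.map m∸n≡0⇒m≤n m∸n≡0⇒m≤n (m∸[m∸n]≡0⇒ (d i + p 2F j ∸ d j) (d j + p 2F i ∸ d i) eq)

  Disjoint₃⇒clash≡0 : ∀ {i j} → Disjoint₃ i j → clash i j ≡ 0
  Disjoint₃⇒clash≡0 {i} {j} (inj₁ x≤) =
    trans (cong (λ x → x ∸ (x ∸ (d j + p 2F i ∸ d i))) (m≤n⇒m∸n≡0 x≤)) (0∸n≡0 (0 ∸ (d j + p 2F i ∸ d i)))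
  Disjoint₃⇒clash≡0 {i} {j} (inj₂ y≤) =
    trans (cong (λ y → x ∸ (x ∸ y)) (m≤n⇒m∸n≡0 y≤)) (n∸n≡0 x)
    where x = d i + p 2F j ∸ d j

  -- Intervals with a common right end overlap, because processing times are positive.
  Disjoint₃⇒d≢ : ∀ {i j} → Disjoint₃ i j → d i ≢ d j
  Disjoint₃⇒d≢ {i} {j} (inj₁ le) eq = <⇒≱ (m<m+n (d i) (p>0 2F j)) (subst (d i + p 2F j ≤_) (sym eq) le)
  Disjoint₃⇒d≢ {i} {j} (inj₂ le) eq = <⇒≱ (m<m+n (d j) (p>0 2F i)) (subst (d j + p 2F i ≤_) eq le)

  clashes≡0⇒ : ∀ {j} L → sum (map (λ i → clash i j) L) ≡ 0 → All (λ i → Disjoint₃ i j) L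
  clashes≡0⇒     []      _  = []
  clashes≡0⇒ {j} (i ∷ L) eq =
    clash≡0⇒Disjoint₃ (m+n≡0⇒m≡0 (clash i j) eq) ∷ clashes≡0⇒ L (m+n≡0⇒n≡0 (clash i j) eq)

  clashes≡0 : ∀ {j L} → All (λ i → Disjoint₃ i j) L → sum (map (λ i → clash i j) L) ≡ 0
  clashes≡0 []       = refl
  clashes≡0 {j} (_∷_ {i} x xs) rewrite Disjoint₃⇒clash≡0 {i} {j} x = clashes≡0 xs

  good-disjoint : ∀ {j L} → obstruction j L ≡ 0 → All (λ i → Disjoint₃ i j) L
  good-disjoint {j} {L} eq = clashes≡0⇒ L (m+n≡0⇒n≡0 (lateness j L) eq)

  good-early : ∀ {j L} → obstruction j L ≡ 0 → completion₂ (j ∷ L) + p 2F j ≤ d j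
  good-early {j} {L} eq = m∸n≡0⇒m≤n (m+n≡0⇒m≡0 (lateness j L) eq)

  good-unique-d : ∀ {L} → Good L → Unique (map d L)
  good-unique-d []       = []
  good-unique-d (eq ∷ g) =
    All.map⁺ (All.map (λ x → Disjoint₃⇒d≢ x ∘ sym) (good-disjoint eq)) ∷ good-unique-d g

  -- The due dates along a good sequence are distinct and occur among the `#d` different ones, so
  -- the pigeonhole principle applies. This bounds the depth of the search tree.
  good-length : ∀ {L} → Good L → length L ≤ #d
  good-length {L} g = subst (_≤ #d) (length-map d L) (Unique-⊆⇒length≤ (good-unique-d g) d-in)
    where
    d-in : ∀ {x} → x ∈ map d L → x ∈ deduplicate _≟_ (tabulate d)
    d-in x∈ with j , _ , refl ← ∈-map⁻ d x∈ = ∈-deduplicate⁺ _≟_ (∈-tabulate⁺ j)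

  good-unique : ∀ {L} → Good L → Unique L
  good-unique = Unique.map⁻ ∘ good-unique-d

  members : Subset n → Seq
  members E = filter (T? ∘ Vec.lookup E) (allFin n)

  ∈-members⁺ : ∀ {E j} → j Subset.∈ E → j ∈ members E
  ∈-members⁺ {E} j∈E = ∈-filter⁺ (T? ∘ Vec.lookup E) (∈-allFin _)
    (Equivalence.from T-≡ (Vec.[]=⇒lookup j∈E))

  ∈-members⁻ : ∀ {E j} → j ∈ members E → j Subset.∈ E
  ∈-members⁻ {E} j∈ = Vec.lookup⇒[]= _ E
    (Equivalence.to T-≡ (proj₂ (∈-filter⁻ (T? ∘ Vec.lookup E) {xs = allFin n} j∈)))

  members-unique : ∀ E → Unique (members E)
  members-unique E = Unique.filter⁺ (T? ∘ Vec.lookup E) (Unique.allFin⁺ n)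

  totalWeight-members : ∀ E → totalWeight (members E) ≡ weight I E
  totalWeight-members E = trans (sum-filter w (Vec.lookup E) (allFin n))
    (cong sum (map-tabulate id (λ j → if Vec.lookup E j then w j else 0)))

  totalWeight-↭ : ∀ {L L′} → L ↭ L′ → totalWeight L ≡ totalWeight L′
  totalWeight-↭ = sum-↭ ∘ map⁺ w

  -- Two lists without repetition and with the same elements are permutations of each other; this is
  -- applied to `L` and `members E`.
  weight-unique : ∀ {E L} → Unique L → (∀ j → j ∈ L ⇔ j Subset.∈ E) → totalWeight L ≡ weight I E
  weight-unique {E} {L} L! L⇔E = trans
    (totalWeight-↭ (∼bag⇒↭ (unique∧set⇒bag L! (members-unique E)
      (λ {j} → mk⇔ (∈-members⁺ ∘ Equivalence.to (L⇔E j)) (Equivalence.from (L⇔E j) ∘ ∈-members⁻)))))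
    (totalWeight-members E)

  -- From sequences to schedules

  -- Common treatment of the first two machines: `begin j L` is the time at which `j` starts after
  -- the jobs of `L`, and the two bounds say that jobs are stacked in time without overlap.
  module Stack (m : Fin 3) (completion : Seq → ℕ) (begin : Fin n → Seq → ℕ)
    (begin≥ : ∀ j L → completion L ≤ begin j L)
    (begin≤ : ∀ j L → begin j L + p m j ≤ completion (j ∷ L)) where

    startOf : Seq → Fin n → ℕ
    startOf []      j = 0
    startOf (i ∷ L) j = if does (j Fin.≟ i) then begin i L else startOf L j

    startOf-≤ : ∀ {L j} → j ∈ L → startOf L j + p m j ≤ completion L
    startOf-≤ {i ∷ L} {j} j∈ with j Fin.≟ i
    ... | yes refl = begin≤ i L
    ... | no  j≢i with j∈
    ...   | here eq  = contradiction eq j≢i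
    ...   | there j∈ = ≤-trans (startOf-≤ j∈) (≤-trans (begin≥ i L) (≤-trans (m≤m+n _ _) (begin≤ i L)))

    startOf-disjoint : ∀ {L j j′} → j ∈ L → j′ ∈ L → j ≢ j′ →
                       startOf L j + p m j ≤ startOf L j′ ⊎ startOf L j′ + p m j′ ≤ startOf L j
    startOf-disjoint {i ∷ L} {j} {j′} j∈ j′∈ j≢j′ with j Fin.≟ i | j′ Fin.≟ i
    ... | yes refl | yes refl = contradiction refl j≢j′
    ... | yes refl | no j′≢i  = inj₂ (≤-trans (startOf-≤ (Any.tail j′≢i j′∈)) (begin≥ i L))
    ... | no j≢i   | yes refl = inj₁ (≤-trans (startOf-≤ (Any.tail j≢i j∈)) (begin≥ i L))
    ... | no j≢i   | no j′≢i  = startOf-disjoint (Any.tail j≢i j∈) (Any.tail j′≢i j′∈) j≢j′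

  module M₁ = Stack 0F completion₁ (λ _ → completion₁) (λ _ _ → ≤-refl)
    (λ j L → ≤-reflexive (+-comm (completion₁ L) (p 0F j)))

  module M₂ = Stack 1F completion₂ (λ j L → completion₁ (j ∷ L) ⊔ completion₂ L)
    (λ j L → m≤n⊔m (completion₁ (j ∷ L)) (completion₂ L)) (λ _ _ → ≤-refl)

  start₁≤start₂ : ∀ {L j} → j ∈ L → M₁.startOf L j + p 0F j ≤ M₂.startOf L j
  start₁≤start₂ {i ∷ L} {j} j∈ with j Fin.≟ i
  ... | yes refl = ≤-trans (≤-reflexive (+-comm (completion₁ L) (p 0F i))) (m≤m⊔n _ _)
  ... | no j≢i   = start₁≤start₂ (Any.tail j≢i j∈)

  start₂-early : ∀ {L j} → Good L → j ∈ L → M₂.startOf L j + p 1F j + p 2F j ≤ d j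
  start₂-early {i ∷ L} {j} (eq ∷ g) j∈ with j Fin.≟ i
  ... | yes refl = good-early {L = L} eq
  ... | no j≢i   = start₂-early g (Any.tail j≢i j∈)

  good-pairwise : ∀ {L i j} → Good L → i ∈ L → j ∈ L → i ≢ j → Disjoint₃ i j
  good-pairwise (eq ∷ g) (here refl) (here refl) i≢j = contradiction refl i≢j
  good-pairwise (eq ∷ g) (here refl) (there j∈)  _   = Sum.swap (All.lookup (good-disjoint eq) j∈)
  good-pairwise (eq ∷ g) (there i∈)  (here refl) _   = All.lookup (good-disjoint eq) i∈
  good-pairwise (eq ∷ g) (there i∈)  (there j∈)  i≢j = good-pairwise g i∈ j∈ i≢j

  good⇒feasible : ∀ {L E} → Good L → (∀ {j} → j Subset.∈ E → j ∈ L) → Feasible I E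
  good⇒feasible {L} {E} g E⊆L = record
    { start     = λ i j → toℚ (s i j)
    ; available = λ i j _ → toℚ-mono-≤ {0} {s i j} z≤n
    ; flow      = flow
    ; capacity  = λ i j j′ j∈ j′∈ j≢j′ → Sum.map (lift i j) (lift i j′) (disjoint i (E⊆L j∈) (E⊆L j′∈) j≢j′)
    ; jit       = jit
    }
    where
    s : Fin 3 → Fin n → ℕ
    s 0F j = M₁.startOf L j
    s 1F j = M₂.startOf L j
    -- On the last machine the due date dictates the start. For the jobs of `L` the subtraction is
    -- exact by `p₃≤d`.
    s 2F j = d j ∸ p 2F j

    lift : ∀ i j {b} → s i j + p i j ≤ b → toℚ (s i j) ℚ.+ toℚ (p i j) ℚ.≤ toℚ b
    lift i j le = ℚ.≤-trans (ℚ.≤-reflexive (sym (toℚ-+ (s i j) (p i j)))) (toℚ-mono-≤ le)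

    p₃≤d : ∀ {j} → j ∈ L → p 2F j ≤ d j
    p₃≤d j∈ = m+n≤o⇒n≤o _ (start₂-early g j∈)

    s₃+p₃≡d : ∀ {j} → j ∈ L → s 2F j + p 2F j ≡ d j
    s₃+p₃≡d j∈ = m∸n+n≡m (p₃≤d j∈)

    before : ∀ {i j} → i ∈ L → d i + p 2F j ≤ d j → s 2F i + p 2F i ≤ s 2F j
    before {i} {j} i∈ le = subst (_≤ s 2F j) (sym (s₃+p₃≡d i∈)) (m+n≤o⇒m≤o∸n (d i) le)

    disjoint : ∀ i {j j′} → j ∈ L → j′ ∈ L → j ≢ j′ → s i j + p i j ≤ s i j′ ⊎ s i j′ + p i j′ ≤ s i j
    disjoint 0F j∈ j′∈ j≢j′ = M₁.startOf-disjoint j∈ j′∈ j≢j′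
    disjoint 1F j∈ j′∈ j≢j′ = M₂.startOf-disjoint j∈ j′∈ j≢j′
    disjoint 2F j∈ j′∈ j≢j′ = Sum.map (before j∈) (before j′∈) (good-pairwise g j∈ j′∈ j≢j′)

    flow : ∀ i i′ j → toℕ i′ ≡ suc (toℕ i) → j Subset.∈ E → toℚ (s i j) ℚ.+ toℚ (p i j) ℚ.≤ toℚ (s i′ j)
    flow 0F 1F j _ j∈ = lift 0F j (start₁≤start₂ (E⊆L j∈))
    flow 1F 2F j _ j∈ = lift 1F j (m+n≤o⇒m≤o∸n _ (start₂-early g (E⊆L j∈)))

    jit : ∀ i j → suc (toℕ i) ≡ 3 → j Subset.∈ E → toℚ (s i j) ℚ.+ toℚ (p i j) ≡ toℚ (d j)
    jit 2F j _ j∈ = trans (sym (toℚ-+ (s 2F j) (p 2F j))) (cong toℚ (s₃+p₃≡d (E⊆L j∈)))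

  -- From schedules to sequences.  Ordering the jobs by their start times on the
  -- second machine loses nothing: all jobs up to j have left the first machine
  -- when j starts on the second one.

  module _ {E : Subset n} (S : JITSchedule I E) where
    open JITSchedule S

    -- Otherwise `j` would finish by the start of `i`, hence by its own start, against its positive
    -- processing time.
    start-order : ∀ m {i j} → i Subset.∈ E → j Subset.∈ E → i ≢ j → start m i ℚ.≤ start m j →
                  finish m i ℚ.≤ start m j
    start-order m {i} {j} i∈ j∈ i≢j le with capacity m i j i∈ j∈ i≢j
    ... | inj₁ i→j = i→j
    ... | inj₂ j→i = contradiction (ℚ.≤-trans j→i le) (x+toℚ≰x (p>0 m j))

    -- The head starts last, so all other jobs are finished when it starts; the induction continues
    -- with that start time in place of `t`.
    packing-sorted : ∀ m {L t} → All (Subset._∈ E) L → Unique L →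
                     AllPairs (λ i j → start m j ℚ.≤ start m i) L →
                     All (λ j → finish m j ℚ.≤ t) L → 0ℚ ℚ.≤ t → toℚ (sum (map (p m) L)) ℚ.≤ t
    packing-sorted m []       _          _            _        0≤t = 0≤t
    packing-sorted m {j ∷ L} {t} (j∈ ∷ L∈) (j≢ ∷ L!) (j≥ ∷ L≥) (f≤ ∷ _) _ =
      ℚ.≤-trans (ℚ.≤-reflexive (cong toℚ (+-comm (p m j) _)))
        (ℚ.≤-trans (toℚ-+-mono-≤ (sum (map (p m) L)) (p m j)
          (packing-sorted m L∈ L! L≥ before (available m j j∈)) ℚ.≤-refl) f≤)
      where
      before : All (λ i → finish m i ℚ.≤ start m j) L
      before = All.map (λ (i∈ , j≢i , le) → start-order m i∈ j∈ (j≢i ∘ sym) le)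
        (All.zip (L∈ , All.zip (j≢ , j≥)))

    -- Needed on the first machine for a list ordered by the second one. The total does not depend
    -- on the order, so the jobs are re-sorted by their start times on `m`.
    packing : ∀ m {L t} → All (Subset._∈ E) L → Unique L →
              All (λ j → finish m j ℚ.≤ t) L → 0ℚ ℚ.≤ t → toℚ (sum (map (p m) L)) ℚ.≤ t
    packing m {L} {t} L∈ L! f≤ 0≤t with L′ , L′↭L , L′≥ ← sort-descending (start m) L =
      subst (λ s → toℚ s ℚ.≤ t) (sum-↭ (map⁺ (p m) L′↭L))
        (packing-sorted m (All-resp-↭ (↭-sym L′↭L) L∈)
          (Unique-resp-↭ (setoid (Fin n)) (↭⇒↭ₛ (↭-sym L′↭L)) L!) L′≥ (All-resp-↭ (↭-sym L′↭L) f≤) 0≤t)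

    schedule⇒disjoint₃ : ∀ {i j} → i Subset.∈ E → j Subset.∈ E → i ≢ j → Disjoint₃ i j
    schedule⇒disjoint₃ i∈ j∈ i≢j = Sum.map (before i∈ j∈) (before j∈ i∈) (capacity 2F _ _ i∈ j∈ i≢j)
      where
      before : ∀ {i j} → i Subset.∈ E → j Subset.∈ E → finish 2F i ℚ.≤ start 2F j → d i + p 2F j ≤ d j
      before {i} {j} i∈ j∈ le = toℚ-cancel-≤ (ℚ.≤-trans
        (toℚ-+-mono-≤ (d i) (p 2F j) (ℚ.≤-trans (ℚ.≤-reflexive (sym (jit 2F i refl i∈))) le) ℚ.≤-refl)
        (ℚ.≤-reflexive (jit 2F j refl j∈)))

    -- The second component strengthens the induction: the greedy schedule on the second machine is
    -- never behind the given one. `List.take 1 L` addresses the head of `L`, if there is one.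
    sorted⇒good : ∀ {L} → All (Subset._∈ E) L → Unique L →
                  AllPairs (λ i j → start 1F j ℚ.≤ start 1F i) L →
                  Good L × All (λ j → toℚ (completion₂ L) ℚ.≤ finish 1F j) (List.take 1 L)
    sorted⇒good []        _         _         = [] , []
    sorted⇒good {j ∷ L} (j∈ ∷ L∈) (j≢ ∷ L!) (j≥ ∷ L≥) with g , top ← sorted⇒good L∈ L! L≥ =
      cong₂ _+_ (m≤n⇒m∸n≡0 early) (clashes≡0 disjoint) ∷ g , completion₂≤ ∷ []
      where
      disjoint : All (λ i → Disjoint₃ i j) L
      disjoint = All.map (λ (i∈ , j≢i) → schedule⇒disjoint₃ i∈ j∈ (j≢i ∘ sym)) (All.zip (L∈ , j≢))

      completion₁≤ : toℚ (completion₁ (j ∷ L)) ℚ.≤ start 1F j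
      completion₁≤ = packing 0F (j∈ ∷ L∈) (j≢ ∷ L!)
        (All.map (λ (i∈ , le) → ℚ.≤-trans (flow 0F 1F _ refl i∈) le)
          (All.zip (j∈ ∷ L∈ , ℚ.≤-refl ∷ j≥)))
        (available 1F j j∈)

      previous≤ : ∀ {L} → All (Subset._∈ E) L → All (j ≢_) L → All (λ i → start 1F i ℚ.≤ start 1F j) L →
                  All (λ i → toℚ (completion₂ L) ℚ.≤ finish 1F i) (List.take 1 L) →
                  toℚ (completion₂ L) ℚ.≤ start 1F j
      previous≤ []       _          _        _          = available 1F j j∈
      previous≤ (i∈ ∷ _) (j≢i ∷ _) (le ∷ _) (c≤ ∷ []) =
        ℚ.≤-trans c≤ (start-order 1F i∈ j∈ (j≢i ∘ sym) le)

      completion₂≤ : toℚ (completion₂ (j ∷ L)) ℚ.≤ finish 1F j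
      completion₂≤ = toℚ-+-mono-≤ (completion₁ (j ∷ L) ⊔ completion₂ L) (p 1F j)
        (toℚ-⊔-lub {completion₁ (j ∷ L)} {completion₂ L} completion₁≤ (previous≤ L∈ j≢ j≥ top)) ℚ.≤-refl

      early : completion₂ (j ∷ L) + p 2F j ≤ d j
      early = toℚ-cancel-≤ (ℚ.≤-trans
        (toℚ-+-mono-≤ (completion₂ (j ∷ L)) (p 2F j) (ℚ.≤-trans completion₂≤ (flow 1F 2F j refl j∈)) ℚ.≤-refl)
        (ℚ.≤-reflexive (jit 2F j refl j∈)))

    feasible⇒good : ∃[ L ] Good L × totalWeight L ≡ weight I E
    feasible⇒good with L , L↭E , L≥ ← sort-descending (start 1F) (members E) =
      L ,
      proj₁ (sorted⇒good (All-resp-↭ (↭-sym L↭E) (All.tabulate ∈-members⁻))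
        (Unique-resp-↭ (setoid (Fin n)) (↭⇒↭ₛ (↭-sym L↭E)) (members-unique E)) L≥) ,
      trans (totalWeight-↭ L↭E) (totalWeight-members E)

-- Updated functions, bounded sums and the size of complete trees

set : ∀ {A : Set} → (ℕ → A) → ℕ → A → ℕ → A
set f i x j = if j ≡ᵇ i then x else f j

set-same : ∀ {A : Set} (f : ℕ → A) i x → set f i x i ≡ x
set-same f i x with i ≡ᵇ i | ≡⇒≡ᵇ i i refl
... | true | _ = refl

set-other : ∀ {A : Set} (f : ℕ → A) {i j} x → j ≢ i → set f i x j ≡ f j
set-other f {i} {j} x j≢i with j ≡ᵇ i | ≡ᵇ⇒≡ j i
... | false | _  = refl
... | true  | eq = contradiction (eq _) j≢i

set-below : ∀ {A : Set} (f : ℕ → A) {l v} x → v ≤ l → set f (suc l) x v ≡ f v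
set-below f x v≤l = set-other f x (<⇒≢ (s≤s v≤l))

sumBelow : ℕ → (ℕ → ℕ) → ℕ
sumBelow zero    f = 0
sumBelow (suc m) f = sumBelow m f + f m

sumBelow-cong : ∀ m {f g} → (∀ {v} → v < m → f v ≡ g v) → sumBelow m f ≡ sumBelow m g
sumBelow-cong zero    eq = refl
sumBelow-cong (suc m) eq = cong₂ _+_ (sumBelow-cong m (λ v<m → eq (m≤n⇒m≤1+n v<m))) (eq (n<1+n m))

sumBelow-mono : ∀ {m m′} f → m ≤ m′ → sumBelow m f ≤ sumBelow m′ f
sumBelow-mono f m≤m′ = helper f (≤⇒≤′ m≤m′)
  where
  helper : ∀ {m m′} f → m ≤′ m′ → sumBelow m f ≤ sumBelow m′ f
  helper f ≤′-refl        = ≤-refl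
  helper f (≤′-step m≤m′) = ≤-trans (helper f m≤m′) (m≤m+n _ _)

sumBelow-suc : ∀ m f → sumBelow m (λ v → suc (f v)) ≡ m + sumBelow m f
sumBelow-suc zero    f = refl
sumBelow-suc (suc m) f = trans (cong (_+ suc (f m)) (sumBelow-suc m f)) (lemma m (sumBelow m f) (f m))
  where
  lemma : ∀ a b c → a + b + suc c ≡ suc a + (b + c)
  lemma = solve-∀

-- The number of nodes of a tree of height < r with b children everywhere.

branch : ℕ → ℕ → ℕ
branch b zero    = 0
branch b (suc r) = suc (b * branch b r)

-- The search tree

module SearchTree (I : FlowShop 3) where
  open FlowShop I
  open Sequences I

  -- A node v > 0 stands for the sequence consisting of job v followed by the
  -- sequence of parent v.

  record Tree : Set where
    constructor tree
    field
      parent job c₁ c₂ wt : ℕ → ℕ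
      last best           : ℕ

  -- By `u ≤ v` parents precede their children, so a path to a stored node never meets the cell
  -- written for a new node.
  data Path (parent job : ℕ → ℕ) : ℕ → Seq → Set where
    root : Path parent job 0 []
    node : ∀ {v u j L} → parent (suc v) ≡ u → u ≤ v → job (suc v) ≡ toℕ j →
           Path parent job u L → Path parent job (suc v) (j ∷ L)

  path-root : ∀ {parent job L} → Path parent job 0 L → L ≡ []
  path-root root = refl

  path-extend : ∀ {parent job l v L} u i → v ≤ l → Path parent job v L →
                Path (set parent (suc l) u) (set job (suc l) i) v L
  path-extend u i v≤l root = root
  path-extend {parent} {job} u i v≤l (node eq u≤v j≡ path) =
    node (trans (set-below parent u v≤l) eq) u≤v (trans (set-below job i v≤l) j≡)
         (path-extend u i (≤-trans u≤v (<⇒≤ v≤l)) path)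

  record Node (T : Tree) (v : ℕ) (L : Seq) : Set where
    open Tree T
    field
      path : Path parent job v L
      c₁≡  : c₁ v ≡ completion₁ L
      c₂≡  : c₂ v ≡ completion₂ L
      wt≡  : wt v ≡ totalWeight L
      good : Good L

  -- At most `#d ∸ length L` jobs can still be appended to `L`. So `size L` bounds the subtree at
  -- `L`, and `children L` the subtree at any single child; the latter is `size (j ∷ L)` by
  -- definition.
  size children : Seq → ℕ
  size     L = branch n (suc #d ∸ length L)
  children L = branch n (#d ∸ length L)

  size≡ : ∀ {L} → Good L → size L ≡ suc (n * children L)
  size≡ g = cong (branch n) (+-∸-assoc 1 (good-length g))

  -- The state of the breadth-first search after the nodes below h have been
  -- expanded, and the node h by the jobs below j.

  record Explored (T : Tree) (S : ℕ → Seq) (h j : ℕ) : Set where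
    open Tree T
    field
      nodes     : ∀ {v} → v ≤ last → Node T v (S v)
      head≤     : h ≤ suc last
      best≤     : best ≤ last
      best-max  : ∀ {v} → v ≤ last → wt v ≤ wt best
      closed    : ∀ {v i} → v ≤ last → v < h ⊎ v ≡ h × toℕ i < j → Good (i ∷ S v) →
                  ∃[ u ] u ≤ last × S u ≡ i ∷ S v
      -- Amortised count: `branch n (suc #d)` pays for the root, and each pair of a node `v` and a
      -- job already tried at it grants `children (S v)`, the `size` of the one node that this trial
      -- may have added.
      potential : sumBelow (suc last) (λ v → size (S v)) ≤
                  branch n (suc #d) + (sumBelow h (λ v → n * children (S v)) + j * children (S h))

  open Tree
  open Node
  open Explored

  -- Zero-initialised memory already represents the tree that consists of the root alone, so
  -- `solver` starts searching at once.
  explored-initial : Explored (tree (λ _ → 0) (λ _ → 0) (λ _ → 0) (λ _ → 0) (λ _ → 0) 0 0) (λ _ → []) 0 0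
  explored-initial .nodes z≤n = record { path = root ; c₁≡ = refl ; c₂≡ = refl ; wt≡ = refl ; good = [] }
  explored-initial .head≤ = z≤n
  explored-initial .best≤ = z≤n
  explored-initial .best-max _ = z≤n
  explored-initial .closed _ (inj₁ ())
  explored-initial .closed _ (inj₂ (_ , ()))
  explored-initial .potential = m≤m+n _ _

  module _ {T : Tree} {S : ℕ → Seq} {h : ℕ} where

    explored-skip : ∀ {i} → Explored T S h (toℕ i) → ¬ Good (i ∷ S h) → Explored T S h (suc (toℕ i))
    explored-skip e _ .nodes     = nodes e
    explored-skip e _ .head≤     = head≤ e
    explored-skip e _ .best≤     = best≤ e
    explored-skip e _ .best-max  = best-max e
    explored-skip e _ .closed v≤ (inj₁ v<h) g = closed e v≤ (inj₁ v<h) g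
    explored-skip {i} e bad .closed {i = i′} v≤ (inj₂ (refl , s≤s i′≤i)) g with i′ Fin.≟ i
    ... | yes refl = contradiction g bad
    ... | no i′≢i  = closed e v≤ (inj₂ (refl , ≤∧≢⇒< i′≤i (λ eq → i′≢i (Fin.toℕ-injective eq)))) g
    explored-skip {i} e _ .potential =
      ≤-trans (potential e) (+-monoʳ-≤ (branch n (suc #d))
        (+-monoʳ-≤ (sumBelow h (λ v → n * children (S v))) (*-monoˡ-≤ (children (S h)) (n≤1+n (toℕ i)))))

    explored-next : Explored T S h n → h ≤ last T → Explored T S (suc h) 0
    explored-next e _   .nodes     = nodes e
    explored-next e h≤l .head≤     = s≤s h≤l
    explored-next e _   .best≤     = best≤ e
    explored-next e _   .best-max  = best-max e
    explored-next e _   .closed {v} v≤ (inj₁ (s≤s v≤h)) g with m≤n⇒m<n∨m≡n v≤h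
    ... | inj₁ v<h = closed e v≤ (inj₁ v<h) g
    ... | inj₂ v≡h = closed e v≤ (inj₂ (v≡h , Fin.toℕ<n _)) g
    explored-next e _   .potential =
      ≤-trans (potential e) (+-monoʳ-≤ (branch n (suc #d)) (≤-reflexive (sym (+-identityʳ _))))

    -- For each node up to `h`, `size` exceeds `n * children` by one. Compared with `potential`, the
    -- grants of the nodes below `h` cancel, and one unit per node remains.
    explored-bound : Explored T S h 0 → h ≤ last T → h < branch n (suc #d)
    explored-bound e h≤l = +-cancelʳ-≤ added (suc h) (branch n (suc #d)) (begin
      suc h + added                                        ≤⟨ +-monoʳ-≤ (suc h) (m≤m+n added _) ⟩
      suc h + sumBelow (suc h) (λ v → n * children (S v))  ≡⟨ sumBelow-suc (suc h) _ ⟨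
      sumBelow (suc h) (λ v → suc (n * children (S v)))    ≡⟨ sumBelow-cong (suc h) size≡′ ⟨
      sumBelow (suc h) (λ v → size (S v))                  ≤⟨ sumBelow-mono _ (s≤s h≤l) ⟩
      sumBelow (suc (last T)) (λ v → size (S v))           ≤⟨ potential e ⟩
      branch n (suc #d) + (added + 0)                      ≡⟨ cong (branch n (suc #d) +_) (+-identityʳ added) ⟩
      branch n (suc #d) + added                            ∎)
      where
      open ≤-Reasoning
      added = sumBelow h (λ v → n * children (S v))

      size≡′ : ∀ {v} → v < suc h → size (S v) ≡ suc (n * children (S v))
      size≡′ (s≤s v≤h) = size≡ (good (nodes e (≤-trans v≤h h≤l)))

    -- Induction along the sequence: its tail is stored at some node, and as every stored node has
    -- been expanded, `closed` supplies the extension.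
    explored-complete : Explored T S h 0 → last T < h → ∀ {L} → Good L → ∃[ u ] u ≤ last T × S u ≡ L
    explored-complete e l<h [] = 0 , z≤n , path-root (path (nodes e z≤n))
    explored-complete e l<h (eq ∷ g) with u , u≤l , refl ← explored-complete e l<h g =
      closed e u≤l (inj₁ (≤-<-trans u≤l l<h)) (eq ∷ g)

    explored-optimal : Explored T S h 0 → last T < h → ∀ {L} → Good L → totalWeight L ≤ totalWeight (S (best T))
    explored-optimal e l<h g with u , u≤l , refl ← explored-complete e l<h g =
      subst₂ _≤_ (wt≡ (nodes e u≤l)) (wt≡ (nodes e (best≤ e))) (best-max e u≤l)

  push : Tree → (u j x₁ x₂ x b : ℕ) → Tree
  push T u j x₁ x₂ x b = record
    { parent = set (parent T) (suc (last T)) u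
    ; job    = set (job T) (suc (last T)) j
    ; c₁     = set (c₁ T) (suc (last T)) x₁
    ; c₂     = set (c₂ T) (suc (last T)) x₂
    ; wt     = set (wt T) (suc (last T)) x
    ; last   = suc (last T)
    ; best   = b
    }

  -- The index `b` is left open to serve both branches of the test that ends `append`: the old best
  -- node stays, or the new node replaces it.
  explored-push : ∀ {T S h i x₁ x₂ x b} → Explored T S h (toℕ i) → h ≤ last T → Good (i ∷ S h) →
    x₁ ≡ completion₁ (i ∷ S h) → x₂ ≡ completion₂ (i ∷ S h) → x ≡ totalWeight (i ∷ S h) →
    let T′ = push T h (toℕ i) x₁ x₂ x b in
    b ≤ last T′ → wt T′ (best T) ≤ wt T′ b → wt T′ (last T′) ≤ wt T′ b →
    Explored T′ (set S (last T′) (i ∷ S h)) h (suc (toℕ i))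
  explored-push {T} {S} {h} {i} {x₁} {x₂} {x} {b} e h≤l g x₁≡ x₂≡ x≡ b≤ old≤ new≤ = record
    { nodes     = nodes′
    ; head≤     = m≤n⇒m≤1+n (head≤ e)
    ; best≤     = b≤
    ; best-max  = best-max′
    ; closed    = closed′
    ; potential = potential′
    }
    where
    l = last T
    T′ = push T h (toℕ i) x₁ x₂ x b
    S′ = set S (suc l) (i ∷ S h)

    S′-below : ∀ {v} → v ≤ l → S′ v ≡ S v
    S′-below = set-below S (i ∷ S h)

    S′-new : S′ (suc l) ≡ i ∷ S h
    S′-new = set-same S (suc l) (i ∷ S h)

    old-node : ∀ {v} → v ≤ l → Node T′ v (S v)
    old-node v≤l = record
      { path = path-extend h (toℕ i) v≤l (path nd)
      ; c₁≡  = trans (set-below (c₁ T) x₁ v≤l) (c₁≡ nd)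
      ; c₂≡  = trans (set-below (c₂ T) x₂ v≤l) (c₂≡ nd)
      ; wt≡  = trans (set-below (wt T) x v≤l) (wt≡ nd)
      ; good = good nd
      }
      where nd = nodes e v≤l

    new-node : Node T′ (suc l) (i ∷ S h)
    new-node = record
      { path = node (set-same (parent T) (suc l) h) h≤l (set-same (job T) (suc l) (toℕ i)) (path (old-node h≤l))
      ; c₁≡  = trans (set-same (c₁ T) (suc l) x₁) x₁≡
      ; c₂≡  = trans (set-same (c₂ T) (suc l) x₂) x₂≡
      ; wt≡  = trans (set-same (wt T) (suc l) x) x≡
      ; good = g
      }

    nodes′ : ∀ {v} → v ≤ suc l → Node T′ v (S′ v)
    nodes′ v≤ with m≤n⇒m<n∨m≡n v≤
    ... | inj₁ (s≤s v≤l) = subst (Node T′ _) (sym (S′-below v≤l)) (old-node v≤l)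
    ... | inj₂ refl      = subst (Node T′ _) (sym S′-new) new-node

    best-max′ : ∀ {v} → v ≤ suc l → wt T′ v ≤ wt T′ b
    best-max′ v≤ with m≤n⇒m<n∨m≡n v≤
    ... | inj₂ refl      = new≤
    ... | inj₁ (s≤s v≤l) = ≤-trans (subst₂ _≤_ (sym (set-below (wt T) x v≤l))
                                      (sym (set-below (wt T) x (best≤ e))) (best-max e v≤l)) old≤

    old-closed : ∀ {v i′} → v ≤ l → v < h ⊎ v ≡ h × toℕ i′ < toℕ i → Good (i′ ∷ S′ v) →
                 ∃[ u ] u ≤ suc l × S′ u ≡ i′ ∷ S′ v
    old-closed {v} {i′} v≤l done g′
      with u , u≤l , eq ← closed e v≤l done (subst (λ L → Good (i′ ∷ L)) (S′-below v≤l) g′) =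
      u , m≤n⇒m≤1+n u≤l , trans (S′-below u≤l) (trans eq (cong (i′ ∷_) (sym (S′-below v≤l))))

    closed′ : ∀ {v i′} → v ≤ suc l → v < h ⊎ v ≡ h × toℕ i′ < suc (toℕ i) → Good (i′ ∷ S′ v) →
              ∃[ u ] u ≤ suc l × S′ u ≡ i′ ∷ S′ v
    closed′ _ (inj₁ v<h) g′ = old-closed (≤-trans (<⇒≤ v<h) h≤l) (inj₁ v<h) g′
    closed′ {i′ = i′} _ (inj₂ (refl , s≤s i′≤i)) g′ with i′ Fin.≟ i
    ... | no i′≢i  = old-closed h≤l (inj₂ (refl , ≤∧≢⇒< i′≤i (λ eq → i′≢i (Fin.toℕ-injective eq)))) g′
    ... | yes refl = suc l , ≤-refl , trans S′-new (cong (i ∷_) (sym (S′-below h≤l)))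

    -- The new node contributes `size (i ∷ S h)`, which is `children (S h)` and thus exactly the
    -- grant for trying `i` at `h`.
    potential′ : sumBelow (suc (suc l)) (λ v → size (S′ v)) ≤
      branch n (suc #d) + (sumBelow h (λ v → n * children (S′ v)) + suc (toℕ i) * children (S′ h))
    potential′
      rewrite sumBelow-cong (suc l) {λ v → size (S′ v)} {λ v → size (S v)}
                (λ v<l → cong size (S′-below (≤-pred v<l)))
            | sumBelow-cong h {λ v → n * children (S′ v)} {λ v → n * children (S v)}
                (λ v<h → cong (λ L → n * children L) (S′-below (≤-trans (<⇒≤ v<h) h≤l)))
            | S′-below h≤l | S′-new
            = ≤-trans (+-monoˡ-≤ y (potential e))
                (≤-reflexive (lemma (branch n (suc #d)) (sumBelow h _) (toℕ i * y) y))
      where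
      y = children (S h)
      lemma : ∀ a b c y → a + (b + c) + y ≡ a + (b + (y + c))
      lemma = solve-∀

-- The program

infix 30 $_

$_ : ℕ → Expr
$ a = a [ lit 0 ]

OUT PARENT JOB C₁ C₂ WT H LAST J BAD V BEST T₁ T₂ : ℕ
OUT    = 1
PARENT = 2
JOB    = 3
C₁     = 4
C₂     = 5
WT     = 6
H      = 7
LAST   = 8
J      = 9
BAD    = 10
V      = 11
BEST   = 12
T₁     = 13
T₂     = 14

-- The five fields of job j occupy the input cells 1 + 5 j, …, 5 + 5 j.

fieldOf : ℕ → Expr → Expr
fieldOf r j = 0 [ lit (suc r) ⊕ (j ⊕ j ⊕ j ⊕ j ⊕ j) ]

p₁ p₂ p₃ due wgt : Expr → Expr
p₁  = fieldOf 0
p₂  = fieldOf 1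
p₃  = fieldOf 2
due = fieldOf 3
wgt = fieldOf 4

-- Node 0 is the root and stands for no job, so the climb along the parents stops there.
walk : Program → Program
walk P = while lit 1 ⊑ $ V repeat (P ⨾ V [ lit 0 ]≔ PARENT [ $ V ])

excess : Expr → Expr → Expr
excess i j = due i ⊕ p₃ j ⊖ due j

tally : Program
tally = BAD [ lit 0 ]≔ $ BAD ⊕ (excess i j ⊖ (excess i j ⊖ excess j i))
  where
  i = JOB [ $ V ]
  j = $ J

probe : Program
probe =
  T₁  [ lit 0 ]≔ p₁ ($ J) ⊕ C₁ [ $ H ] ⨾
  T₂  [ lit 0 ]≔ $ T₁ ⊕ (C₂ [ $ H ] ⊖ $ T₁) ⊕ p₂ ($ J) ⨾
  BAD [ lit 0 ]≔ $ T₂ ⊕ p₃ ($ J) ⊖ due ($ J) ⨾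
  V   [ lit 0 ]≔ $ H ⨾
  walk tally

append : Program
append =
  -- With the literal in front, the new value reduces to a successor.
  LAST   [ lit 0 ]≔ lit 1 ⊕ $ LAST ⨾
  PARENT [ $ LAST ]≔ $ H ⨾
  JOB    [ $ LAST ]≔ $ J ⨾
  C₁     [ $ LAST ]≔ $ T₁ ⨾
  C₂     [ $ LAST ]≔ $ T₂ ⨾
  WT     [ $ LAST ]≔ wgt ($ J) ⊕ WT [ $ H ] ⨾
  if (WT [ $ LAST ]) ⊑ (WT [ $ BEST ]) then skip else′ (BEST [ lit 0 ]≔ $ LAST)

extend : Program
extend = probe ⨾ if $ BAD ⊑ lit 0 then append else′ skip

expand : Program
expand =
  J [ lit 0 ]≔ lit 0 ⨾
  while (lit 1 ⊕ $ J) ⊑ $ 0 repeat (extend ⨾ J [ lit 0 ]≔ lit 1 ⊕ $ J) ⨾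
  H [ lit 0 ]≔ lit 1 ⊕ $ H

mark : Program
mark = OUT [ JOB [ $ V ] ]≔ lit 1

solver : Program
solver =
  while $ H ⊑ $ LAST repeat expand ⨾
  V [ lit 0 ]≔ $ BEST ⨾
  walk mark

-- Reading the encoded instance

nth-++ˡ : ∀ xs {ys r} → r < length xs → nth (xs ++ ys) r ≡ nth xs r
nth-++ˡ (x ∷ xs) {r = zero}  _         = refl
nth-++ˡ (x ∷ xs) {r = suc r} (s≤s r<l) = nth-++ˡ xs r<l

nth-++ʳ : ∀ xs {ys} r → nth (xs ++ ys) (length xs + r) ≡ nth ys r
nth-++ʳ []       r = refl
nth-++ʳ (x ∷ xs) r = nth-++ʳ xs r

nth-concat : ∀ {m k} (f : Fin m → List ℕ) → (∀ i → length (f i) ≡ k) → ∀ i {r} → r < k →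
             nth (concat (tabulate f)) (toℕ i * k + r) ≡ nth (f i) r
nth-concat f eq 0F      r<k = nth-++ˡ (f 0F) (subst (_ <_) (sym (eq 0F)) r<k)
nth-concat {k = k} f eq (suc i) {r} r<k =
  trans (cong (nth (f 0F ++ concat (tabulate (f ∘ suc)))) index)
    (trans (nth-++ʳ (f 0F) (toℕ i * k + r)) (nth-concat (f ∘ suc) (eq ∘ suc) i r<k))
  where
  index : k + toℕ i * k + r ≡ length (f 0F) + (toℕ i * k + r)
  index = trans (+-assoc k _ r) (cong (_+ (toℕ i * k + r)) (sym (eq 0F)))

at-0 : ∀ {f g : ℕ → ℕ} → f ≡ g → f 0 ≡ g 0
at-0 = cong (λ f → f 0)

-- Correctness and step count of the program

module Verification (I : FlowShop 3) where
  open FlowShop I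
  open Sequences I
  open SearchTree I
  open Node
  open Explored

  input : ℕ → ℕ
  input = nth (encodeFlowShop I)

  block : Fin n → List ℕ
  block i = p 0F i ∷ p 1F i ∷ p 2F i ∷ d i ∷ w i ∷ []

  field-value : ∀ {f x} i r → r < 5 → f ≡ input → x ≡ toℕ i →
                f (suc r + (x + x + x + x + x)) ≡ nth (block i) r
  field-value i r r<5 refl refl =
    trans (cong (nth (concat (tabulate block))) (index r (toℕ i))) (nth-concat block (λ _ → refl) i r<5)
    where
    index : ∀ r x → r + (x + x + x + x + x) ≡ x * 5 + r
    index = solve-∀

  view : Store → Tree
  view σ = tree (σ PARENT) (σ JOB) (σ C₁) (σ C₂) (σ WT) (σ LAST 0) (σ BEST 0)

  -- `probe` writes only `T₁`, `T₂`, `BAD` and `V`, so it leaves the tree intact.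
  view-cong : ∀ {σ′ σ} → (∀ a → (a ∉ᵂ probe) ≡ true → σ′ a ≡ σ a) → view σ′ ≡ view σ
  view-cong {σ′} {σ} same =
    helper (same PARENT refl) (same JOB refl) (same C₁ refl) (same C₂ refl) (same WT refl)
      (at-0 (same LAST refl)) (at-0 (same BEST refl))
    where
    helper : ∀ {a b c d e a′ b′ c′ d′ e′ : ℕ → ℕ} {x y x′ y′} → a ≡ a′ → b ≡ b′ → c ≡ c′ → d ≡ d′ → e ≡ e′ →
             x ≡ x′ → y ≡ y′ → tree a b c d e x y ≡ tree a′ b′ c′ d′ e′ x′ y′
    helper refl refl refl refl refl refl refl = refl

  -- `Q L` is the invariant with the jobs of `L` still to be visited. A round costs 4 for the test,
  -- `c` for the body and 5 for the climb; the failing test at the root costs another 4.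
  run-walk : ∀ {P c} (Q : Seq → Store → Set) →
    (∀ L {σ v} → Q L σ → Q L (σ [ V , 0 ↦ v ])) →
    (∀ {σ j} L → σ JOB (σ V 0) ≡ toℕ j → Q (j ∷ L) σ → Run P σ c (Q L)) →
    (PARENT ∉ᵂ P) ≡ true → (JOB ∉ᵂ P) ≡ true → (V ∉ᵂ P) ≡ true →
    ∀ {L v σ} → Path (σ PARENT) (σ JOB) v L → σ V 0 ≡ v → Q L σ →
    Run (walk P) σ (4 + length L * (9 + c)) (Q [])
  run-walk Q stable body P∉ J∉ V∉ root V≡ q =
    run (while-stop (s≤s (≤-reflexive V≡))) ≤-refl q
  run-walk {P} {c} Q stable body P∉ J∉ V∉ {j ∷ L} {σ = σ} (node {v} {u} parent≡ _ job≡ path) V≡ q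
    with run x t≤ (q′ , same) ← run-frame (body {σ} L (trans (cong (σ JOB) V≡) job≡) q)
    with run y t′≤ q″ ← run-walk {P} {c} Q stable body P∉ J∉ V∉ {L} {u}
           (subst₂ (λ f g → Path f g u L) (sym (same PARENT P∉)) (sym (same JOB J∉)) path)
           (trans (cong₂ (λ f g → f (g 0)) (same PARENT P∉) (same V V∉))
             (trans (cong (σ PARENT) V≡) parent≡)) (stable L q′)
    = run (while-step (subst (1 ≤_) (sym V≡) (s≤s z≤n)) (seq x assign) y)
        (≤-trans (+-monoʳ-≤ 4 (+-mono-≤ (+-monoˡ-≤ 5 t≤) t′≤)) (≤-reflexive (arith c (length L * (9 + c))))) q″
    where
    arith : ∀ c x → 4 + (c + 5 + (4 + x)) ≡ 4 + (9 + c + x)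
    arith = solve-∀

  clash-cong : ∀ {dᵢ pⱼ dⱼ pᵢ i j} → dᵢ ≡ d i → pⱼ ≡ p 2F j → dⱼ ≡ d j → pᵢ ≡ p 2F i →
               (dᵢ + pⱼ ∸ dⱼ) ∸ ((dᵢ + pⱼ ∸ dⱼ) ∸ (dⱼ + pᵢ ∸ dᵢ)) ≡ clash i j
  clash-cong refl refl refl refl = refl

  Tallied : Fin n → ℕ → Seq → Store → Set
  Tallied j total L σ = σ 0 ≡ input × σ J 0 ≡ toℕ j × σ BAD 0 + sum (map (λ i → clash i j) L) ≡ total

  run-tally : ∀ {j total σ i} L → σ JOB (σ V 0) ≡ toℕ i → Tallied j total (i ∷ L) σ →
              Run tally σ 200 (Tallied j total L)
  run-tally {j} {total} {σ} {i} L i≡ (in≡ , j≡ , sum≡) =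
    run-weaken (run-assign (in≡ , j≡ , trans tally≡ sum≡)) (≤ᵇ⇒≤ _ _ _)
    where
    s = sum (map (λ i → clash i j) L)

    tally≡ : (σ [ BAD , 0 ↦ _ ]) BAD 0 + s ≡ σ BAD 0 + (clash i j + s)
    tally≡ = trans (+-assoc (σ BAD 0) _ s) (cong (λ x → σ BAD 0 + (x + s)) (clash-cong {i = i} {j = j}
      (field-value i 3 (≤ᵇ⇒≤ _ _ _) in≡ i≡) (field-value j 2 (≤ᵇ⇒≤ _ _ _) in≡ j≡)
      (field-value j 3 (≤ᵇ⇒≤ _ _ _) in≡ j≡) (field-value i 2 (≤ᵇ⇒≤ _ _ _) in≡ i≡)))

  record Probed (j : Fin n) (L : Seq) (σ : Store) : Set where
    field
      completion₁≡ : σ T₁ 0 ≡ completion₁ (j ∷ L)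
      completion₂≡ : σ T₂ 0 ≡ completion₂ (j ∷ L)
      obstruction≡ : σ BAD 0 ≡ obstruction j L

  -- The four assignments cost 96 and the last test of the walk 4. Each round of the walk costs 9
  -- besides `tally`, whose cost is rounded up to 200.
  probeCost : ℕ → ℕ
  probeCost l = 100 + l * 209

  run-probe : ∀ {σ j L} → σ 0 ≡ input → σ J 0 ≡ toℕ j → Node (view σ) (σ H 0) L →
              Run probe σ (probeCost (length L)) (Probed j L)
  run-probe {σ} {j} {L} in≡ j≡ nd =
    run-assign-then (run-assign-then (run-assign-then (run-assign-then
      (run-map probed (run-frame
        (run-walk (Tallied j (obstruction j L)) (λ _ q → q) run-tally refl refl refl (path nd) refl
          (in≡ , j≡ , cong (_+ sum (map (λ i → clash i j) L)) late)))))))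
    where
    x₁ = σ 0 (1 + (σ J 0 + σ J 0 + σ J 0 + σ J 0 + σ J 0)) + σ C₁ (σ H 0)
    x₂ = x₁ + (σ C₂ (σ H 0) ∸ x₁) + σ 0 (2 + (σ J 0 + σ J 0 + σ J 0 + σ J 0 + σ J 0))

    x₁≡ : x₁ ≡ completion₁ (j ∷ L)
    x₁≡ = cong₂ _+_ (field-value j 0 (≤ᵇ⇒≤ _ _ _) in≡ j≡) (c₁≡ nd)

    x₂≡ : x₂ ≡ completion₂ (j ∷ L)
    x₂≡ = cong₂ _+_ (trans (m+[n∸m]≡m⊔n x₁ _) (cong₂ _⊔_ x₁≡ (c₂≡ nd))) (field-value j 1 (≤ᵇ⇒≤ _ _ _) in≡ j≡)

    late : x₂ + σ 0 (3 + (σ J 0 + σ J 0 + σ J 0 + σ J 0 + σ J 0))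
             ∸ σ 0 (4 + (σ J 0 + σ J 0 + σ J 0 + σ J 0 + σ J 0)) ≡ lateness j L
    late = cong₂ _∸_ (cong₂ _+_ x₂≡ (field-value j 2 (≤ᵇ⇒≤ _ _ _) in≡ j≡)) (field-value j 3 (≤ᵇ⇒≤ _ _ _) in≡ j≡)

    σ₁ σ₂ σ₃ σ₄ : Store
    σ₁ = σ [ T₁ , 0 ↦ x₁ ]
    σ₂ = σ₁ [ T₂ , 0 ↦ x₂ ]
    σ₃ = σ₂ [ BAD , 0 ↦ x₂ + σ 0 (3 + (σ J 0 + σ J 0 + σ J 0 + σ J 0 + σ J 0))
                          ∸ σ 0 (4 + (σ J 0 + σ J 0 + σ J 0 + σ J 0 + σ J 0)) ]
    σ₄ = σ₃ [ V , 0 ↦ σ H 0 ]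

    probed : ∀ {σ′} → Tallied j (obstruction j L) [] σ′ ×
             (∀ a → (a ∉ᵂ walk tally) ≡ true → σ′ a ≡ σ₄ a) → Probed j L σ′
    probed ((_ , _ , bad≡) , same) = record
      { completion₁≡ = trans (at-0 (same T₁ refl)) x₁≡
      ; completion₂≡ = trans (at-0 (same T₂ refl)) x₂≡
      ; obstruction≡ = trans (sym (+-identityʳ _)) bad≡
      }

  run-append : ∀ {σ S h j} → σ 0 ≡ input → σ H 0 ≡ h → σ J 0 ≡ toℕ j → h ≤ σ LAST 0 →
               Explored (view σ) S h (toℕ j) → Good (j ∷ S h) → Probed j (S h) σ →
               Run append σ 100 (λ σ′ → h ≤ σ′ LAST 0 × ∃[ S′ ] Explored (view σ′) S′ h (suc (toℕ j)))
  run-append {σ} {S} {_} {j} in≡ refl j≡ h≤ e g pr = run-weaken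
    (run-assign-then (run-assign-then (run-assign-then (run-assign-then (run-assign-then (run-assign-then
      (run-if
        (λ new≤ → run-weaken (run-skip (m≤n⇒m≤1+n h≤ , _ ,
           pushed j≡ x≡ (m≤n⇒m≤1+n (best≤ e)) ≤-refl new≤)) (≤ᵇ⇒≤ 1 4 _))
        (λ old< → run-assign (m≤n⇒m≤1+n h≤ , _ ,
           pushed j≡ x≡ ≤-refl (<⇒≤ old<) ≤-refl)))))))))
    (≤ᵇ⇒≤ _ _ _)
    where
    x = σ 0 (5 + (σ J 0 + σ J 0 + σ J 0 + σ J 0 + σ J 0)) + σ WT (σ H 0)

    x≡ : x ≡ totalWeight (j ∷ S (σ H 0))
    x≡ = cong₂ _+_ (field-value j 4 (≤ᵇ⇒≤ _ _ _) in≡ j≡) (wt≡ (nodes e h≤))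

    pushed : ∀ {j′ x b} → j′ ≡ toℕ j → x ≡ totalWeight (j ∷ S (σ H 0)) →
             let T′ = push (view σ) (σ H 0) j′ (σ T₁ 0) (σ T₂ 0) x b in
             b ≤ suc (σ LAST 0) → Tree.wt T′ (σ BEST 0) ≤ Tree.wt T′ b →
             Tree.wt T′ (suc (σ LAST 0)) ≤ Tree.wt T′ b →
             Explored T′ (set S (suc (σ LAST 0)) (j ∷ S (σ H 0))) (σ H 0) (suc (toℕ j))
    pushed refl x≡ b≤ old≤ new≤ =
      explored-push e h≤ g (Probed.completion₁≡ pr) (Probed.completion₂≡ pr) x≡ b≤ old≤ new≤

  Expanding : ℕ → ℕ → Store → Set
  Expanding h j σ = σ 0 ≡ input × σ H 0 ≡ h × σ J 0 ≡ j × j ≤ n × h ≤ σ LAST 0 × ∃[ S ] Explored (view σ) S h j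

  good⇒obstruction≡0 : ∀ {j L} → Good (j ∷ L) → obstruction j L ≡ 0
  good⇒obstruction≡0 (eq ∷ _) = eq

  -- The sequence at `H` has at most `#d` jobs; the test of `BAD` costs 4, and 100 covers either
  -- branch.
  extendCost : ℕ
  extendCost = probeCost #d + 104

  run-extend : ∀ {σ h} j → Expanding h (toℕ j) σ →
               Run extend σ extendCost (λ σ′ → h ≤ σ′ LAST 0 × ∃[ S ] Explored (view σ′) S h (suc (toℕ j)))
  run-extend {σ} {h} j (in≡ , refl , j≡ , _ , h≤ , S , e) = run-weaken
    (run-frame (run-probe in≡ j≡ (nodes e h≤)) ⨟ λ (pr , same) →
      let view≡ = view-cong same
          e′ = subst (λ T → Explored T S h (toℕ j)) (sym view≡) e
          h≤′ = subst (λ T → h ≤ Tree.last T) (sym view≡) h≤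
      in run-if
        (λ bad≤0 → run-append (trans (same 0 refl) in≡) (at-0 (same H refl))
          (trans (at-0 (same J refl)) j≡) h≤′ e′
          (trans (sym (Probed.obstruction≡ pr)) (n≤0⇒n≡0 bad≤0) ∷ good (nodes e h≤)) pr)
        (λ bad>0 → run-weaken (run-skip (h≤′ , S , explored-skip e′ λ g →
            n≮n 0 (subst (0 <_) (trans (Probed.obstruction≡ pr) (good⇒obstruction≡0 g)) bad>0)))
          (≤ᵇ⇒≤ 1 100 _) ))
    (+-monoˡ-≤ 104 (+-monoʳ-≤ 100 (*-monoˡ-≤ 209 (good-length (good (nodes e h≤))))))

  run-extend-next : ∀ {σ h} i → Expanding h (toℕ i) σ →
                    Run (extend ⨾ J [ lit 0 ]≔ lit 1 ⊕ $ J) σ (extendCost + 6) (Expanding h (suc (toℕ i)))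
  run-extend-next i ex@(in≡ , h≡ , j≡ , _) = run-frame (run-extend i ex) ⨟ λ (next , same) →
    run-assign (trans (same 0 refl) in≡ , trans (at-0 (same H refl)) h≡ ,
      cong suc (trans (at-0 (same J refl)) j≡) , Fin.toℕ<n i , next)

  expandCost : ℕ
  expandCost = 3 + (7 + n * (7 + (extendCost + 6)) + 6)

  Searching : ℕ → Store → Set
  Searching h σ = σ 0 ≡ input × σ H 0 ≡ h × ∃[ S ] Explored (view σ) S h 0

  run-expand : ∀ {σ h} → Searching h σ → σ H 0 ≤ σ LAST 0 → Run expand σ expandCost (Searching (suc h))
  run-expand {σ} {h} (in≡ , refl , S , e) h≤ =
    run-assign-then
      (run-while (Expanding h) n step n ≤-refl (in≡ , refl , refl , z≤n , h≤ , S , e) ⨟ finish)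
    where
    step : ∀ {j σ} → Expanding h j σ → 1 + σ J 0 ≤ σ 0 0 →
           j < n × Run (extend ⨾ J [ lit 0 ]≔ lit 1 ⊕ $ J) σ (extendCost + 6) (Expanding h (suc j))
    step {j} {σ} ex@(in≡ , _ , j≡ , _) holds = j<n ,
      -- The loop counter is a number, whereas `run-extend-next` speaks of a job.
      subst (λ j → Expanding h j σ → Run _ σ (extendCost + 6) (Expanding h (suc j)))
        (Fin.toℕ-fromℕ< j<n) (run-extend-next (fromℕ< j<n)) ex
      where
      j<n : j < n
      j<n = subst₂ _<_ j≡ (at-0 in≡) holds

    finish : ∀ {σ} → (σ 0 0 < 1 + σ J 0) × (∃[ j ] Expanding h j σ) →
             Run (H [ lit 0 ]≔ lit 1 ⊕ $ H) σ 6 (Searching (suc h))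
    finish (fails , j , in≡ , h≡ , j≡ , j≤n , h≤ , S , e) =
      -- The failed test gives `n ≤ j` and the invariant `j ≤ n`, so every job has been tried at
      -- `h`.
      run-assign (in≡ , cong suc h≡ , S , explored-next (subst (Explored _ S _)
        (≤-antisym j≤n (subst₂ _≤_ (at-0 in≡) j≡ (≤-pred fails))) e) h≤)

  -- The jobs of `L` are still to be marked; `pending` is what keeps `sound` true when the next of
  -- them is.
  record Marking (L₀ L : Seq) (σ : Store) : Set where
    field
      pending  : ∀ {i} → i ∈ L → i ∈ L₀
      sound    : ∀ i → 0 < σ OUT (toℕ i) → i ∈ L₀
      complete : ∀ {i} → i ∈ L₀ → i ∈ L ⊎ 0 < σ OUT (toℕ i)

  open Marking

  run-mark : ∀ {L₀ σ j} L → σ JOB (σ V 0) ≡ toℕ j → Marking L₀ (j ∷ L) σ → Run mark σ 5 (Marking L₀ L)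
  run-mark {L₀} {σ} {j} L j≡ m = run-assign marked
    where
    out : ℕ → ℕ
    out = set (σ OUT) (σ JOB (σ V 0)) 1

    out-same : out (toℕ j) ≡ 1
    out-same = subst (λ i → out i ≡ 1) j≡ (set-same (σ OUT) _ 1)

    out-other : ∀ {i} → i ≢ j → out (toℕ i) ≡ σ OUT (toℕ i)
    out-other i≢j = set-other (σ OUT) 1 (λ eq → i≢j (Fin.toℕ-injective (trans eq j≡)))

    marked : Marking L₀ L (σ [ OUT , σ JOB (σ V 0) ↦ 1 ])
    marked .pending i∈ = pending m (there i∈)
    marked .sound i 0<out with i Fin.≟ j
    ... | yes refl = pending m (here refl)
    ... | no i≢j   = sound m i (subst (0 <_) (out-other i≢j) 0<out)
    marked .complete {i} i∈ with i Fin.≟ j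
    ... | yes refl = inj₂ (subst (0 <_) (sym out-same) (s≤s z≤n))
    ... | no i≢j with complete m i∈
    ...   | inj₁ i∈L   = inj₁ (Any.tail i≢j i∈L)
    ...   | inj₂ 0<out = inj₂ (subst (0 <_) (sym (out-other i≢j)) 0<out)

  searchCost markCost : ℕ
  searchCost = 5 + branch n (suc #d) * (5 + expandCost)
  markCost   = 4 + #d * 14

  record Solved (σ : Store) : Set where
    field
      best-sequence : Seq
      best-good     : Good best-sequence
      best-optimal  : ∀ {L} → Good L → totalWeight L ≤ totalWeight best-sequence
      output-sound  : ∀ i → 0 < σ OUT (toℕ i) → i ∈ best-sequence
      output-complete : ∀ {i} → i ∈ best-sequence → 0 < σ OUT (toℕ i)

  run-search : Run (while $ H ⊑ $ LAST repeat expand) (load (encodeFlowShop I)) searchCost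
    (λ σ → σ LAST 0 < σ H 0 × ∃[ h ] Searching h σ)
  run-search = run-while Searching (branch n (suc #d)) step (branch n (suc #d)) ≤-refl
    (refl , refl , _ , explored-initial)
    where
    step : ∀ {h σ} → Searching h σ → σ H 0 ≤ σ LAST 0 →
           h < branch n (suc #d) × Run expand σ expandCost (Searching (suc h))
    step s@(_ , refl , _ , e) h≤ = explored-bound e h≤ , run-expand s h≤

  run-solver : Run solver (load (encodeFlowShop I)) (searchCost + (4 + markCost)) Solved
  run-solver = run-frame run-search ⨟ λ { {σ} ((l<h , h , _ , refl , S , e) , same) →
    run-assign-then (run-weaken
      (run-map (solved {σ} l<h e) (run-walk (Marking (S (σ BEST 0)))
        (λ L m → record { pending = pending m ; sound = sound m ; complete = complete m })
        run-mark refl refl refl (path (nodes e (best≤ e))) refl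
        -- The search never writes to `OUT`, which is therefore still zero when the marking begins.
        (record { pending = λ i∈ → i∈ ; sound = λ i → unmarked (same OUT refl) ; complete = inj₁ })))
      (+-monoʳ-≤ 4 (*-monoˡ-≤ 14 (good-length (good (nodes e (best≤ e))))))) }
    where
    unmarked : ∀ {f : ℕ → ℕ} {i} {A : Set} → f ≡ (λ _ → 0) → 0 < f i → A
    unmarked refl ()

    solved : ∀ {σ σ′ S} → σ LAST 0 < σ H 0 → Explored (view σ) S (σ H 0) 0 →
             Marking (S (σ BEST 0)) [] σ′ → Solved σ′
    solved {σ} {S = S} l<h e m = record
      { best-sequence = S (σ BEST 0)
      ; best-good     = good (nodes e (best≤ e))
      ; best-optimal  = explored-optimal e l<h
      ; output-sound  = sound m
      ; output-complete = λ i∈ → case complete m i∈ of λ where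
          (inj₂ 0<out) → 0<out
      }

-- Optimality of the output

open FlowShop using (n; #d)

-- The marked jobs are exactly those of the best good sequence, and any feasible set yields a good
-- sequence of the same weight to compare it with.
solved⇒optimal : ∀ I {σ} → Verification.Solved I σ → Optimal I (decodeSubset I (σ 1))
solved⇒optimal I {σ} s =
  good⇒feasible best-good (output-sound _ ∘ ∈E⁻) ,
  λ E′ feasible → heaviest {E′} (feasible⇒good feasible)
  where
  open Sequences I
  open Verification I
  open Solved s

  E = decodeSubset I (σ 1)

  ∈E⁺ : ∀ {j} → 0 < σ 1 (toℕ j) → j Subset.∈ E
  ∈E⁺ {j} 0<out = Vec.lookup⇒[]= j E (trans (Vec.lookup∘tabulate _ j) (Equivalence.to T-≡ (<⇒<ᵇ 0<out)))

  ∈E⁻ : ∀ {j} → j Subset.∈ E → 0 < σ 1 (toℕ j)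
  ∈E⁻ {j} j∈E = <ᵇ⇒< _ _ (Equivalence.from T-≡ (trans (sym (Vec.lookup∘tabulate _ j)) (Vec.[]=⇒lookup j∈E)))

  weight≡ : totalWeight best-sequence ≡ weight I E
  weight≡ = weight-unique (good-unique best-good)
    (λ j → mk⇔ (∈E⁺ ∘ output-complete) (output-sound j ∘ ∈E⁻))

  heaviest : ∀ {E′} → ∃[ L ] Good L × totalWeight L ≡ weight I E′ → weight I E′ ≤ weight I E
  heaviest (L , g , eq) = subst₂ _≤_ eq weight≡ (best-optimal g)

-- Running time

#d≤n : ∀ {m} (I : FlowShop m) → #d I ≤ n I
#d≤n I = ≤-trans (length-deduplicate _≟_ (tabulate d)) (≤-reflexive (length-tabulate d))
  where open FlowShop I using (d)

branch-1 : ∀ r → branch 1 r ≡ r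
branch-1 zero    = refl
branch-1 (suc r) = cong suc (trans (+-identityʳ _) (branch-1 r))

-- The `suc` on the left makes the induction close: the resulting 2 is at most `2 + b`, which
-- completes the product.
branch-power : ∀ b r → suc (branch (2 + b) (suc r)) ≤ 2 * (2 + b) ^ r
branch-power b zero    = ≤-reflexive (cong (2 +_) (*-zeroʳ b))
branch-power b (suc r) = begin
  2 + (2 + b) * branch (2 + b) (suc r)        ≤⟨ +-monoˡ-≤ _ (m≤m+n 2 b) ⟩
  (2 + b) + (2 + b) * branch (2 + b) (suc r)  ≡⟨ *-suc (2 + b) (branch (2 + b) (suc r)) ⟨
  (2 + b) * suc (branch (2 + b) (suc r))      ≤⟨ *-monoʳ-≤ (2 + b) (branch-power b r) ⟩
  (2 + b) * (2 * (2 + b) ^ r)                 ≡⟨ swap (2 + b) ((2 + b) ^ r) ⟩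
  2 * ((2 + b) * (2 + b) ^ r)                 ∎
  where
  open ≤-Reasoning
  swap : ∀ x y → x * (2 * y) ≡ 2 * (x * y)
  swap = solve-∀

-- With at least two children per node the last level dominates the geometric sum. With one child
-- the tree is a path of `suc k` nodes, and `k ≤ m` gives `k ≤ 1`.
branch-bound : ∀ {m k} → 0 < m → k ≤ m → branch m (suc k) ≤ 2 * m ^ k
branch-bound {suc zero}    {k} _ k≤1 = begin
  branch 1 (suc k)  ≡⟨ branch-1 (suc k) ⟩
  suc k             ≤⟨ s≤s k≤1 ⟩
  2                 ≡⟨ cong (2 *_) (^-zeroˡ k) ⟨
  2 * 1 ^ k         ∎
  where open ≤-Reasoning
branch-bound {suc (suc b)} {k} _ _ = ≤-trans (n≤1+n _) (branch-power b k)

n≤n! : ∀ k → k ≤ k !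
n≤n! zero    = z≤n
n≤n! (suc k) = ≤-trans (≤-reflexive (sym (*-identityʳ (suc k)))) (*-monoʳ-≤ (suc k) (1≤n! k))

-- The constants are the costs of the straight-line parts of solver.

runningTime : ℕ → ℕ → ℕ
runningTime m k =
  5 + branch m (suc k) * (5 + (3 + (7 + m * (7 + (100 + k * 209 + 104 + 6)) + 6))) + (4 + (4 + k * 14))

-- 447 = 21 + 217 + 209 bounds the work per node and job up to the factor `k !`, there are at most
-- `2 * m ^ k` nodes, and 921 = 5 + 8 + 2 * 447 + 14. For `m = 0` both sides are numerals, and `1 ⊔`
-- carries the bound.
runningTime-bound : ∀ {m k} → k ≤ m → runningTime m k ≤ 921 * (1 ⊔ m ^ suc k * k !)
runningTime-bound {zero}      z≤n = ≤ᵇ⇒≤ _ _ _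
runningTime-bound {m@(suc _)} {k} k≤m = begin
  runningTime m k                                        ≡⟨ simplify nodes m k ⟩
  5 + nodes * (21 + m * (217 + k * 209)) + (8 + k * 14)      ≤⟨ +-mono-≤ (+-monoʳ-≤ 5 search≤) (+-monoʳ-≤ 8 (*-monoˡ-≤ 14 (n≤n! k))) ⟩
  5 + 2 * x * (m * (q * 447)) + (8 + q * 14)             ≡⟨ regroup m x q ⟩
  13 * 1 + (894 * M + 14 * q)                            ≤⟨ +-mono-≤ (*-monoʳ-≤ 13 1≤M) (+-monoʳ-≤ (894 * M) (*-monoʳ-≤ 14 q≤M)) ⟩
  13 * M + (894 * M + 14 * M)                            ≡⟨ collect M ⟩
  921 * M                                                ≤⟨ *-monoʳ-≤ 921 (m≤n⊔m 1 M) ⟩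
  921 * (1 ⊔ M)                                          ∎
  where
  open ≤-Reasoning
  nodes = branch m (suc k)
  x = m ^ k
  q = k !
  M = m ^ suc k * k !

  0<m : 0 < m
  0<m = s≤s z≤n

  q≤M : q ≤ M
  q≤M = ≤-trans (≤-reflexive (sym (*-identityˡ q))) (*-monoˡ-≤ q (m^n>0 m (suc k)))

  1≤M : 1 ≤ M
  1≤M = ≤-trans (1≤n! k) q≤M

  simplify : ∀ b m k → 5 + b * (5 + (3 + (7 + m * (7 + (100 + k * 209 + 104 + 6)) + 6))) + (4 + (4 + k * 14))
             ≡ 5 + b * (21 + m * (217 + k * 209)) + (8 + k * 14)
  simplify = solve-∀

  split : ∀ m q → m * (q * 21) + m * (q * 217 + q * 209) ≡ m * (q * 447)
  split = solve-∀

  inner : 21 + m * (217 + k * 209) ≤ m * (q * 447)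
  inner = ≤-trans (+-mono-≤ (*-mono-≤ 0<m (*-monoˡ-≤ 21 (1≤n! k)))
    (*-monoʳ-≤ m (+-mono-≤ (*-monoˡ-≤ 217 (1≤n! k)) (*-monoˡ-≤ 209 (n≤n! k))))) (≤-reflexive (split m q))

  search≤ : nodes * (21 + m * (217 + k * 209)) ≤ 2 * x * (m * (q * 447))
  search≤ = *-mono-≤ (branch-bound 0<m k≤m) inner

  regroup : ∀ m x q → 5 + 2 * x * (m * (q * 447)) + (8 + q * 14) ≡ 13 * 1 + (894 * (m * x * q) + 14 * q)
  regroup = solve-∀

  collect : ∀ M → 13 * M + (894 * M + 14 * M) ≡ 921 * M
  collect = solve-∀

solvable : SolvableInO (JITFlowShop 3) (λ I → n I ^ suc (#d I) * (#d I) !)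
solvable = solver , 921 , λ I → solution I (Verification.run-solver I)
  where
  solution : ∀ I → Run solver (load (encodeFlowShop I)) (runningTime (n I) (#d I)) (Verification.Solved I) → _
  solution I (run x t≤ s) = _ , _ , (_ , x , refl) , solved⇒optimal I s ,
    ≤-trans t≤ (runningTime-bound (#d≤n I))

-- Membership in XP

n<2^n : ∀ m → m < 2 ^ m
n<2^n zero    = s≤s z≤n
n<2^n (suc m) = +-mono-≤ (m^n>0 2 m) (≤-trans (n<2^n m) (≤-reflexive (sym (+-identityʳ (2 ^ m)))))

!≤^ : ∀ {k s} r → r ≤ k → k ≤ s → r ! ≤ s ^ r
!≤^ zero    _   _   = ≤-refl
!≤^ (suc r) r<k k≤s = *-mono-≤ (≤-trans r<k k≤s) (!≤^ r (<⇒≤ r<k) k≤s)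

length-concat-tabulate : ∀ {m} (f : Fin m → List ℕ) → (∀ i → 0 < length (f i)) →
                         m ≤ length (concat (tabulate f))
length-concat-tabulate {zero}  f 0<f = z≤n
length-concat-tabulate {suc m} f 0<f = ≤-trans
  (+-mono-≤ (0<f 0F) (length-concat-tabulate (f ∘ suc) (0<f ∘ suc)))
  (≤-reflexive (sym (length-++ (f 0F))))

-- In the base `s ≥ 2` the constant is absorbed by `C ≤ s ^ C`, the power of `n` by `n ≤ s`, and the
-- factorial by `k ! ≤ s ^ k`, as `k ≤ n ≤ s`. The sum of the three exponents is computed by one
-- assignment.
solvable⇒XP : SolvableInO (JITFlowShop 3) (λ I → n I ^ suc (#d I) * (#d I) !) → XP (JITFlowShop 3) #d
solvable⇒XP (P , C , solves) =
  f , ((1 [ lit 0 ]≔ lit C ⊕ (lit 1 ⊕ $ 0 ⊕ $ 0)) , λ k → _ , _ , (_ , assign , refl) , refl) ,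
  P , λ I → let t , output , runs , solution , t≤ = solves I in
            t , output , runs , solution , ≤-trans t≤ (bound I)
  where
  f : ℕ → ℕ
  f k = C + (1 + k + k)

  bound : ∀ I → C * (1 ⊔ n I ^ suc (#d I) * (#d I) !) ≤ (2 ⊔ length (encodeFlowShop I)) ^ f (#d I)
  bound I = begin
    C * (1 ⊔ n I ^ suc k * k !)   ≤⟨ *-mono-≤ C≤ (⊔-lub (m^n>0 s (1 + k + k)) M≤) ⟩
    s ^ C * s ^ (1 + k + k)       ≡⟨ ^-distribˡ-+-* s C (1 + k + k) ⟨
    s ^ f k                       ∎
    where
    open ≤-Reasoning
    k = #d I
    l = length (encodeFlowShop I)
    s = 2 ⊔ l

    instance
      s≢0 : NonZero s
      s≢0 = >-nonZero (≤-trans (s≤s z≤n) (m≤m⊔n 2 l))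

    n≤s : n I ≤ s
    n≤s = ≤-trans (length-concat-tabulate _ (λ _ → s≤s z≤n)) (≤-trans (n≤1+n _) (m≤n⊔m 2 l))

    C≤ : C ≤ s ^ C
    C≤ = ≤-trans (<⇒≤ (n<2^n C)) (^-monoˡ-≤ C (m≤m⊔n 2 l))

    M≤ : n I ^ suc k * k ! ≤ s ^ (1 + k + k)
    M≤ = ≤-trans (*-mono-≤ (^-monoˡ-≤ (suc k) n≤s) (!≤^ k ≤-refl (≤-trans (#d≤n I) n≤s)))
      (≤-reflexive (sym (^-distribˡ-+-* s (1 + k) k)))

theorem2 : SolvableInO (JITFlowShop 3) (λ I → n I ^ suc (#d I) * (#d I) !) × XP (JITFlowShop 3) #d
theorem2 = solvable , solvable⇒XP solvable
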